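{- Let $H$ be a graph of pathwidth at most $2$ on $r > 5$ vertices and let $k$ be a positive integer. If a graph $G$ does not contain $k$ vertex-disjoint copies of $H$ as minors, then $\mathbf{tw}(G) \le 2^{O(r^2)}\cdot k^2 \cdot \log 2k$.
   Context: Graphs are finite, simple, undirected. $\mathbf{tw}(G)$ denotes the treewidth of $G$. "$G$ contains $k$ disjoint copies of $H$ as minors" means $G$ contains the disjoint union of $k$ copies of $H$ as a minor (equivalently, $k$ pairwise vertex-disjoint minor models of $H$). Logarithms are binary; the constant in $O(r^2)$ is absolute. -}

module Defs where

open import Data.Nat using (ℕ; zero; suc; _+_; _*_; _^_; _≤_; _<_)
open import Data.Fin using (Fin; inject₁; fromℕ) renaming (zero to fzero; suc to fsuc; _≤_ to _≤ᶠ_)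
open import Data.Fin.Subset using (Subset; _∈_; ∣_∣)
open import Data.Bool using (Bool; true; false)
open import Data.Product using (Σ; ∃; ∃-syntax; _×_; _,_)
open import Relation.Binary.PropositionalEquality using (_≡_; _≢_)
open import Relation.Nullary using (¬_)
open import Data.Empty using (⊥)
open import Function.Definitions using (Injective)

record Graph : Set where
  field
    n      : ℕ
    adj    : Fin n → Fin n → Bool
    sym    : ∀ u v → adj u v ≡ adj v u
    irrefl : ∀ v → adj v v ≡ false

open Graph public

Edge : (G : Graph) → Fin (n G) → Fin (n G) → Set
Edge G u v = adj G u v ≡ true

data WalkIn (G : Graph) (S : Fin (n G) → Set) : Fin (n G) → Fin (n G) → Set where
  here : ∀ {u} → S u → WalkIn G S u u
  step : ∀ {u w v} → S u → Edge G u w → WalkIn G S w v → WalkIn G S u v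

ConnectedSet : (G : Graph) → (Fin (n G) → Set) → Set
ConnectedSet G S = ∀ u v → S u → S v → WalkIn G S u v

Connected : Graph → Set
Connected G = ConnectedSet G (λ _ → Data.Unit.⊤)
  where import Data.Unit

HasCycle : Graph → Set
HasCycle G = ∃[ m ] Σ (Fin (suc (suc (suc m))) → Fin (n G)) λ c →
  Injective _≡_ _≡_ c ×
  (∀ (i : Fin (suc (suc m))) → Edge G (c (inject₁ i)) (c (fsuc i))) ×
  Edge G (c (fromℕ (suc (suc m)))) (c fzero)

IsTree : Graph → Set
IsTree T = (0 < n T) × Connected T × ¬ HasCycle T

record TreeDecomposition (G : Graph) (w : ℕ) : Set where
  field
    T         : Graph
    tree      : IsTree T
    bag       : Fin (n T) → Subset (n G)
    cover-v   : ∀ v → ∃[ t ] v ∈ bag t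
    cover-e   : ∀ u v → Edge G u v → ∃[ t ] (u ∈ bag t × v ∈ bag t)
    coherent  : ∀ v → ConnectedSet T (λ t → v ∈ bag t)
    width     : ∀ t → ∣ bag t ∣ ≤ suc w

TreewidthAtMost : Graph → ℕ → Set
TreewidthAtMost G w = TreeDecomposition G w

record PathDecomposition (G : Graph) (w : ℕ) : Set where
  field
    m         : ℕ
    bag       : Fin m → Subset (n G)
    cover-v   : ∀ v → ∃[ i ] v ∈ bag i
    cover-e   : ∀ u v → Edge G u v → ∃[ i ] (u ∈ bag i × v ∈ bag i)
    interp    : ∀ v (i j l : Fin m) → i ≤ᶠ j → j ≤ᶠ l → v ∈ bag i → v ∈ bag l → v ∈ bag j
    width     : ∀ i → ∣ bag i ∣ ≤ suc w

PathwidthAtMost : Graph → ℕ → Set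
PathwidthAtMost G w = PathDecomposition G w

record DisjointMinorModels (G H : Graph) (k : ℕ) : Set where
  field
    φ         : Fin k → Fin (n H) → Subset (n G)
    nonempty  : ∀ i u → ∃[ x ] x ∈ φ i u
    connected : ∀ i u → ConnectedSet G (λ x → x ∈ φ i u)
    disjoint  : ∀ i j u v → (i , u) ≢ (j , v) → ∀ x → x ∈ φ i u → x ∈ φ j v → ⊥
    edges     : ∀ i u v → Edge H u v → ∃[ x ] ∃[ y ] (x ∈ φ i u × y ∈ φ i v × Edge G x y)

{-# OPTIONS --safe #-}
-- Let s = k r, h = s² + 1 and N = 4 h.  If no set of 5 N vertices is well-linked, repeatedly cutting along balanced
-- separations of order at most N produces a tree-decomposition with bags of size at most 6 N = O(k² r²).
-- Otherwise the well-linked set orients every separation of order at most N towards a big side.  As in Leaf and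
-- Seymour's argument, a comb with 2 h teeth is grown vertex by vertex on the small side of a separation (A, B) such
-- that each branch set contains exactly one vertex of A ∩ B; choosing (A, B) tight (no separation of smaller order
-- lies beyond it) makes Menger's theorem available.  A small separator of the two halves of the teeth inside B minus
-- the spine would cover the well-linked set by three small sides, so h disjoint paths join the two halves.  They turn
-- the two halves of the spine into rails with h rungs of length two, joined in an arbitrary order.  By
-- Erdős–Szekeres, s of the rungs are in monotone order, giving a ladder that splits into k ladders with r rungs; each
-- of these contains H, since a path-decomposition of width 2 can be swept along it with two vertices held on
-- the rails and the newest one on the rung.
module Submission where

open import Defs renaming (sym to adj-sym)
open import Data.Nat using (ℕ; zero; suc; pred; _+_; _*_; _∸_; _^_; _≤_; _<_; z≤n; s≤s; s≤s⁻¹; >-nonZero)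
open import Data.Nat.Properties hiding (_≟_; suc-injective)
open import Data.Nat.Induction using (<-wellFounded)
open import Data.Nat.Solver using (module +-*-Solver)
open +-*-Solver using (solve; con; _:+_; _:*_; _:=_)
open import Induction.WellFounded using (Acc; acc)
open import Data.Fin using (splitAt; inject≤; Fin; toℕ; fromℕ<; inject₁; fromℕ; _↑ˡ_; _↑ʳ_; opposite; combine) renaming (zero to fzero; suc to fsuc)
open import Data.Fin.Relation.Unary.Top using (view; ‵fromℕ; ‵inject₁)
open import Data.Fin.Properties using (combine-injective; toℕ-combine; combine-monoˡ-<; toℕ-inject₁; toℕ-fromℕ; opposite-prop; opposite-involutive; combine-injectiveˡ; combine-injectiveʳ; combine-surjective; splitAt-↑ˡ; splitAt-↑ʳ; splitAt⁻¹-↑ˡ; splitAt⁻¹-↑ʳ; ↑ˡ-injective; ↑ʳ-injective; toℕ-↑ˡ; toℕ-↑ʳ; inject≤-injective; _≟_; any?; all?; toℕ-injective; toℕ<n; toℕ-fromℕ<; injective⇒≤; pigeonhole; suc-injective)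
open import Data.Fin.Subset using (Subset; _∈_; _∉_; _⊆_; ∣_∣; _∩_; _∪_; ∁; ⁅_⁆; _-_; inside; outside) renaming (⊥ to ⊥ˢ; ⊤ to ⊤ˢ)
open import Data.Fin.Subset.Properties
open import Data.Vec using ([]; _∷_; here; there; tabulate)
open import Data.Vec.Properties using (lookup∘tabulate; lookup⇒[]=; []=⇒lookup)
open import Data.List using (List; []; _∷_; length; filter; cartesianProduct; allFin)
open import Data.List.Properties using (length-filter)
import Data.List.Membership.Propositional as L
import Data.List.Relation.Unary.Any as Any
open import Data.List.Membership.Propositional.Properties using (∈-filter⁺; ∈-filter⁻; ∈-cartesianProduct⁺; ∈-allFin)
open import Data.Bool using (Bool; true; false)
open import Data.Bool.Properties using () renaming (_≟_ to _≟ᵇ_)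
open import Data.Unit using (tt) renaming (⊤ to Unit)
open import Data.Maybe using (Maybe; just; nothing)
open import Data.Empty using (⊥; ⊥-elim)
open import Data.Product using (Σ; ∃; ∃-syntax; _×_; _,_; proj₁; proj₂)
open import Data.Sum using (_⊎_; inj₁; inj₂; [_,_]′)
open import Function using (_∘_; id)
open import Function.Definitions using (Injective)
open import Relation.Nullary using (¬_; Dec; yes; no; does)
open import Relation.Nullary.Decidable using (_×-dec_; _⊎-dec_; _→-dec_; ¬?; map′; dec-true)
open import Relation.Binary.Definitions using (tri<; tri≈; tri>)
open import Relation.Binary.PropositionalEquality using (_≡_; _≢_; refl; sym; trans; cong; cong₂; subst; subst₂)

-- Subsets, walks and connected sets

-- The constants count vertices. A comb with `2 h` teeth has `2 h` tooth and `2 h` spine vertices,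
-- so separations up to order `N = 4 h` must be oriented. Three big sides together miss fewer than
-- `3 N` vertices of the well-linked set, and the final contradiction tolerates `2 N` common
-- vertices: hence `5 N`. A bag holds a border of at most `5 N` vertices and a separator of at most
-- `N`: hence `6 N`. One root per branch set is what keeps the rungs apart. The linking paths run
-- inside `B`, where a branch set shows only its root, so a path meets just the two teeth that it
-- joins. The pairing of the teeth cannot be controlled; the price of restoring order is `s * s + 1`
-- rungs for `s` good ones. Well-linkedness is tested in the subgraph induced on the part still to
-- be decomposed, and a minor found there is a minor of the whole graph. Separations of a finite
-- graph can be searched, so every case distinction on their existence is decidable.

comprehension : ∀ {n} {P : Fin n → Set} → (∀ x → Dec (P x)) → Subset n
comprehension P? = tabulate (does ∘ P?)

∈-comprehension⁺ : ∀ {n} {P : Fin n → Set} (P? : ∀ x → Dec (P x)) {x} → P x → x ∈ comprehension P?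
∈-comprehension⁺ P? {x} px = lookup⇒[]= x _ (trans (lookup∘tabulate (does ∘ P?) x) (dec-true (P? x) px))

∈-comprehension⁻ : ∀ {n} {P : Fin n → Set} (P? : ∀ x → Dec (P x)) {x} → x ∈ comprehension P? → P x
∈-comprehension⁻ P? {x} x∈ with P? x | trans (sym (lookup∘tabulate (does ∘ P?) x)) ([]=⇒lookup x∈)
... | yes p | _ = p

∣p∪q∣+∣p∩q∣≡∣p∣+∣q∣ : ∀ {n} (p q : Subset n) → ∣ p ∪ q ∣ + ∣ p ∩ q ∣ ≡ ∣ p ∣ + ∣ q ∣
∣p∪q∣+∣p∩q∣≡∣p∣+∣q∣ [] [] = refl
∣p∪q∣+∣p∩q∣≡∣p∣+∣q∣ (false ∷ p) (false ∷ q) = ∣p∪q∣+∣p∩q∣≡∣p∣+∣q∣ p q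
∣p∪q∣+∣p∩q∣≡∣p∣+∣q∣ (false ∷ p) (true ∷ q) = trans (cong suc (∣p∪q∣+∣p∩q∣≡∣p∣+∣q∣ p q)) (sym (+-suc _ _))
∣p∪q∣+∣p∩q∣≡∣p∣+∣q∣ (true ∷ p) (false ∷ q) = cong suc (∣p∪q∣+∣p∩q∣≡∣p∣+∣q∣ p q)
∣p∪q∣+∣p∩q∣≡∣p∣+∣q∣ (true ∷ p) (true ∷ q) =
  cong suc (trans (+-suc _ _) (trans (cong suc (∣p∪q∣+∣p∩q∣≡∣p∣+∣q∣ p q)) (sym (+-suc _ _))))

∣p∣+∣q∣≤ : ∀ {n} {p q u v : Subset n} → p ⊆ u → q ⊆ u → (∀ {x} → x ∈ p → x ∈ q → x ∈ v) →
  ∣ p ∣ + ∣ q ∣ ≤ ∣ u ∣ + ∣ v ∣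
∣p∣+∣q∣≤ {p = p} {q} {u} {v} p⊆u q⊆u pq⊆v = subst (_≤ ∣ u ∣ + ∣ v ∣) (∣p∪q∣+∣p∩q∣≡∣p∣+∣q∣ p q)
  (+-mono-≤ (p⊆q⇒∣p∣≤∣q∣ (λ x∈ → [ p⊆u , q⊆u ]′ (x∈p∪q⁻ p q x∈)))
            (p⊆q⇒∣p∣≤∣q∣ (λ x∈ → let a , b = x∈p∩q⁻ p q x∈ in pq⊆v a b)))

∣p∣≤∣q∣+∣r∣ : ∀ {n} {p q r : Subset n} → (∀ {x} → x ∈ p → x ∈ q ⊎ x ∈ r) → ∣ p ∣ ≤ ∣ q ∣ + ∣ r ∣
∣p∣≤∣q∣+∣r∣ {p = p} {q} {r} p⊆ = ≤-trans (p⊆q⇒∣p∣≤∣q∣ (x∈p∪q⁺ ∘ p⊆))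
  (subst (∣ q ∪ r ∣ ≤_) (∣p∪q∣+∣p∩q∣≡∣p∣+∣q∣ q r) (m≤m+n _ _))

Enumerates : ∀ {n k} → (Fin k → Fin n) → Subset n → Set
Enumerates f p = Injective _≡_ _≡_ f × (∀ i → f i ∈ p) × (∀ {x} → x ∈ p → ∃[ i ] f i ≡ x)

enumerate : ∀ {n} (p : Subset n) → Σ (Fin ∣ p ∣ → Fin n) λ f → Enumerates f p
enumerate [] = (λ ()) , (λ {}) , (λ ()) , (λ ())
enumerate (false ∷ p) with enumerate p
... | f , f-inj , f∈ , onto = fsuc ∘ f , f-inj ∘ suc-injective , there ∘ f∈ , onto′
  where
  onto′ : ∀ {x} → x ∈ outside ∷ p → ∃[ i ] fsuc (f i) ≡ x
  onto′ (there x∈) = let i , eq = onto x∈ in i , cong fsuc eq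
enumerate (true ∷ p) with enumerate p
... | f , f-inj , f∈ , onto = g , g-inj , g∈ , onto′
  where
  g : Fin (suc ∣ p ∣) → Fin _
  g fzero = fzero
  g (fsuc i) = fsuc (f i)
  g-inj : Injective _≡_ _≡_ g
  g-inj {fzero} {fzero} _ = refl
  g-inj {fsuc i} {fsuc j} eq = cong fsuc (f-inj (suc-injective eq))
  g∈ : ∀ i → g i ∈ inside ∷ p
  g∈ fzero = here
  g∈ (fsuc i) = there (f∈ i)
  onto′ : ∀ {x} → x ∈ inside ∷ p → ∃[ i ] g i ≡ x
  onto′ here = fzero , refl
  onto′ (there x∈) = let i , eq = onto x∈ in fsuc i , cong fsuc eq

injective⇒≤∣p∣ : ∀ {n k} {f : Fin k → Fin n} {p : Subset n} →
  Injective _≡_ _≡_ f → (∀ i → f i ∈ p) → k ≤ ∣ p ∣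
injective⇒≤∣p∣ {f = f} {p} f-inj f∈ =
  let g , _ , _ , onto = enumerate p in
  injective⇒≤ {f = λ i → proj₁ (onto (f∈ i))} λ {i} {j} eq →
    f-inj (trans (sym (proj₂ (onto (f∈ i)))) (trans (cong g eq) (proj₂ (onto (f∈ j)))))

-- A missed member of `p` put in front of `f` would give `suc k` distinct members.
injective⇒Enumerates : ∀ {n k} {f : Fin k → Fin n} {p : Subset n} →
  Injective _≡_ _≡_ f → (∀ i → f i ∈ p) → ∣ p ∣ ≤ k → Enumerates f p
injective⇒Enumerates {n} {k} {f} {p} f-inj f∈ ∣p∣≤k = f-inj , f∈ , onto
  where
  onto : ∀ {x} → x ∈ p → ∃[ i ] f i ≡ x
  onto {x} x∈ with any? (λ i → f i ≟ x)
  ... | yes hit = hit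
  ... | no miss = ⊥-elim (<⇒≱ (injective⇒≤∣p∣ g-inj g∈) ∣p∣≤k)
    where
    g : Fin (suc k) → Fin n
    g fzero = x
    g (fsuc i) = f i
    g-inj : Injective _≡_ _≡_ g
    g-inj {fzero} {fzero} _ = refl
    g-inj {fzero} {fsuc j} eq = ⊥-elim (miss (j , sym eq))
    g-inj {fsuc i} {fzero} eq = ⊥-elim (miss (i , eq))
    g-inj {fsuc i} {fsuc j} eq = cong fsuc (f-inj eq)
    g∈ : ∀ i → g i ∈ p
    g∈ fzero = x∈
    g∈ (fsuc i) = f∈ i

Enumerates⇒∣p∣≡ : ∀ {n k} {f : Fin k → Fin n} {p : Subset n} → Enumerates f p → ∣ p ∣ ≡ k
Enumerates⇒∣p∣≡ {f = f} {p} (f-inj , f∈ , onto) = let g , g-inj , g∈ , _ = enumerate p in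
  ≤-antisym
    (injective⇒≤ {f = λ i → proj₁ (onto (g∈ i))} λ {i} {j} eq →
      g-inj (trans (sym (proj₂ (onto (g∈ i)))) (trans (cong f eq) (proj₂ (onto (g∈ j))))))
    (injective⇒≤∣p∣ f-inj f∈)

data Walk {V : Set} (R : V → V → Set) (S : V → Set) : V → V → Set where
  here : ∀ {u} → S u → Walk R S u u
  step : ∀ {u w v} → S u → R u w → Walk R S w v → Walk R S u v

Conn : {V : Set} → (V → V → Set) → (V → Set) → Set
Conn R S = ∀ u v → S u → S v → Walk R S u v

walk-map : ∀ {V : Set} {R R′ : V → V → Set} {S S′ : V → Set} →
  (∀ {u v} → R u v → R′ u v) → (∀ {u} → S u → S′ u) → ∀ {u v} → Walk R S u v → Walk R′ S′ u v
walk-map r s (here su) = here (s su)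
walk-map r s (step su e p) = step (s su) (r e) (walk-map r s p)

walk-trans : ∀ {V : Set} {R : V → V → Set} {S : V → Set} {u v w} →
  Walk R S u v → Walk R S v w → Walk R S u w
walk-trans (here _) q = q
walk-trans (step s e p) q = step s e (walk-trans p q)

walk-source : ∀ {V : Set} {R : V → V → Set} {S : V → Set} {u v} → Walk R S u v → S u
walk-source (here s) = s
walk-source (step s _ _) = s

walk-sym : ∀ {V : Set} {R : V → V → Set} {S : V → Set} → (∀ {u v} → R u v → R v u) →
  ∀ {u v} → Walk R S u v → Walk R S v u
walk-sym R-sym (here s) = here s
walk-sym R-sym (step s e p) = walk-trans (walk-sym R-sym p) (step (walk-source p) (R-sym e) (here s))

walk-invariant : ∀ {V : Set} {R : V → V → Set} {S T : V → Set} → (∀ {u v} → R u v → T u → T v) →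
  ∀ {u v} → Walk R S u v → T u → T v
walk-invariant t (here _) tu = tu
walk-invariant t (step _ e p) tu = walk-invariant t p (t e tu)

conn-∪ : ∀ {n} {R : Fin n → Fin n → Set} → (∀ {u v} → R u v → R v u) → {p q : Subset n} →
  Conn R (_∈ p) → Conn R (_∈ q) → ∀ {x y} → x ∈ p → y ∈ q → x ≡ y ⊎ R x y → Conn R (_∈ p ∪ q)
conn-∪ {R = R} R-sym {p} {q} cp cq {x} {y} x∈ y∈ link u v u∈ v∈ = go (x∈p∪q⁻ p q u∈) (x∈p∪q⁻ p q v∈)
  where
  bridge : x ≡ y ⊎ R x y → ∀ {u v} → u ∈ p → v ∈ q → Walk R (_∈ p ∪ q) u v
  bridge (inj₁ refl) {u} {v} u∈ v∈ =
    walk-trans (walk-map id (p⊆p∪q q) (cp u x u∈ x∈)) (walk-map id (q⊆p∪q p q) (cq x v y∈ v∈))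
  bridge (inj₂ e) {u} {v} u∈ v∈ =
    walk-trans (walk-map id (p⊆p∪q q) (cp u x u∈ x∈))
      (step (p⊆p∪q q x∈) e (walk-map id (q⊆p∪q p q) (cq y v y∈ v∈)))
  go : ∀ {u v} → u ∈ p ⊎ u ∈ q → v ∈ p ⊎ v ∈ q → Walk R (_∈ p ∪ q) u v
  go (inj₁ u∈) (inj₁ v∈) = walk-map id (p⊆p∪q q) (cp _ _ u∈ v∈)
  go (inj₂ u∈) (inj₂ v∈) = walk-map id (q⊆p∪q p q) (cq _ _ u∈ v∈)
  go (inj₁ u∈) (inj₂ v∈) = bridge link u∈ v∈
  go (inj₂ u∈) (inj₁ v∈) = walk-sym R-sym (bridge link v∈ u∈)

conn-⁅⁆ : ∀ {n} {R : Fin n → Fin n → Set} {x : Fin n} → Conn R (_∈ ⁅ x ⁆)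
conn-⁅⁆ {x = x} u v u∈ v∈ with x∈⁅y⁆⇒x≡y x u∈ | x∈⁅y⁆⇒x≡y x v∈
... | refl | refl = here u∈

-- Menger's theorem

-- Connected sets stand in for paths: branch sets of minors need no more, and unions of them are
-- easy to form. Once `X` has at most `k` vertices, disjointness leaves each set exactly one vertex
-- of `X`, which serves as its end; likewise for `Y`.
record Linkage {n : ℕ} (R : Fin n → Fin n → Set) (X Y : Subset n) (k : ℕ) : Set where
  field
    path     : Fin k → Subset n
    conn     : ∀ i → Conn R (_∈ path i)
    disjoint : ∀ {i j x} → x ∈ path i → x ∈ path j → i ≡ j
    source   : ∀ i → ∃[ x ] x ∈ path i × x ∈ X
    target   : ∀ i → ∃[ y ] y ∈ path i × y ∈ Y

  source-injective : Injective _≡_ _≡_ (proj₁ ∘ source)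
  source-injective {i} {j} eq =
    disjoint (proj₁ (proj₂ (source i))) (subst (_∈ path j) (sym eq) (proj₁ (proj₂ (source j))))

  target-injective : Injective _≡_ _≡_ (proj₁ ∘ target)
  target-injective {i} {j} eq =
    disjoint (proj₁ (proj₂ (target i))) (subst (_∈ path j) (sym eq) (proj₁ (proj₂ (target j))))

  sources : ∣ X ∣ ≤ k → Enumerates (proj₁ ∘ source) X
  sources = injective⇒Enumerates source-injective (proj₂ ∘ proj₂ ∘ source)

  targets : ∣ Y ∣ ≤ k → Enumerates (proj₁ ∘ target) Y
  targets = injective⇒Enumerates target-injective (proj₂ ∘ proj₂ ∘ target)

  at-source : ∣ X ∣ ≤ k → ∀ {i x} → x ∈ path i → x ∈ X → x ≡ proj₁ (source i)
  at-source X≤k {i} x∈i x∈X with proj₂ (proj₂ (sources X≤k)) x∈X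
  ... | j , refl = cong (proj₁ ∘ source) (disjoint (proj₁ (proj₂ (source j))) x∈i)

  at-target : ∣ Y ∣ ≤ k → ∀ {i y} → y ∈ path i → y ∈ Y → y ≡ proj₁ (target i)
  at-target Y≤k {i} y∈i y∈Y with proj₂ (proj₂ (targets Y≤k)) y∈Y
  ... | j , refl = cong (proj₁ ∘ target) (disjoint (proj₁ (proj₂ (target j))) y∈i)

record Separation {n : ℕ} (R : Fin n → Fin n → Set) (P Q : Subset n) : Set where
  field
    cover   : ∀ x → x ∈ P ⊎ x ∈ Q
    nocross : ∀ {u v} → R u v → u ∉ Q → v ∉ P → ⊥

  ∉P⇒∈Q : ∀ {x} → x ∉ P → x ∈ Q
  ∉P⇒∈Q {x} x∉ = [ ⊥-elim ∘ x∉ , id ]′ (cover x)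

  ∉Q⇒∈P : ∀ {x} → x ∉ Q → x ∈ P
  ∉Q⇒∈P {x} x∉ = [ id , ⊥-elim ∘ x∉ ]′ (cover x)

record Separator {n : ℕ} (R : Fin n → Fin n → Set) (X Y : Subset n) (k : ℕ) : Set where
  constructor separator
  field
    P Q   : Subset n
    sep   : Separation R P Q
    X⊆P   : X ⊆ P
    Y⊆Q   : Y ⊆ Q
    order : ∣ P ∩ Q ∣ < k

module _ {n : ℕ} where

  -- The induction for Menger's theorem removes one edge at a time, so its graphs are given by lists
  -- of edges.
  Edges : Set
  Edges = List (Fin n × Fin n)

  Joins : Edges → Fin n → Fin n → Set
  Joins E u v = (u , v) L.∈ E ⊎ (v , u) L.∈ E

  Joins-sym : ∀ {E u v} → Joins E u v → Joins E v u
  Joins-sym (inj₁ e) = inj₂ e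
  Joins-sym (inj₂ e) = inj₁ e

  Joins-there : ∀ {E e u v} → Joins E u v → Joins (e ∷ E) u v
  Joins-there = [ inj₁ ∘ Any.there , inj₂ ∘ Any.there ]′

  Within : Subset n → Fin n × Fin n → Set
  Within p (u , v) = u ∈ p × v ∈ p

  within? : ∀ p e → Dec (Within p e)
  within? p (u , v) = (u ∈? p) ×-dec (v ∈? p)

  restrict : Subset n → Edges → Edges
  restrict p = filter (within? p)

  restrict⁺ : ∀ p {E u v} → Joins E u v → u ∈ p → v ∈ p → Joins (restrict p E) u v
  restrict⁺ p (inj₁ e) u∈ v∈ = inj₁ (∈-filter⁺ (within? p) e (u∈ , v∈))
  restrict⁺ p (inj₂ e) u∈ v∈ = inj₂ (∈-filter⁺ (within? p) e (v∈ , u∈))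

  restrict⁻ : ∀ p {E u v} → Joins (restrict p E) u v → Joins E u v × u ∈ p × v ∈ p
  restrict⁻ p (inj₁ e) = let e′ , u∈ , v∈ = ∈-filter⁻ (within? p) e in inj₁ e′ , u∈ , v∈
  restrict⁻ p (inj₂ e) = let e′ , v∈ , u∈ = ∈-filter⁻ (within? p) e in inj₂ e′ , u∈ , v∈

  AddEdge : Fin n → Fin n → (R R′ : Fin n → Fin n → Set) → Set
  AddEdge x y R R′ = ∀ {u v} → R′ u v → R u v ⊎ (u ≡ x × v ≡ y) ⊎ (u ≡ y × v ≡ x)

  -- `P ∩ Q` with `x` or `y` added has at most `k` vertices, so each vertex of the first set ends
  -- exactly one path of `L₁` and each vertex of the second starts exactly one path of `L₂`. Equal
  -- ends are identified, and the path ending in `x` continues along the edge to `y`.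
  glue : ∀ {R R₁ R₂ : Fin n → Fin n → Set} {X Y P Q x y k} →
    (∀ {u v} → R u v → R v u) →
    (∀ {u v} → R₁ u v → R u v × u ∈ P × v ∈ P) → (∀ {u v} → R₂ u v → R u v × u ∈ Q × v ∈ Q) →
    R x y → x ∉ Q → y ∉ P → X ⊆ P → Y ⊆ Q → ∣ P ∩ Q ∣ < k →
    Linkage R₁ X ((P ∩ Q) ∪ ⁅ x ⁆) k → Linkage R₂ ((P ∩ Q) ∪ ⁅ y ⁆) Y k → Linkage R X Y k
  glue {R} {R₁} {R₂} {X} {Y} {P} {Q} {x} {y} {k} R-sym R₁⊆ R₂⊆ xy x∉Q y∉P X⊆P Y⊆Q order L₁ L₂ = record
    { path = λ i → A.path i ∪ B.path (μ i)
    ; conn = λ i → conn-∪ R-sym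
        (λ u v u∈ v∈ → walk-map (proj₁ ∘ R₁⊆) id (A.conn i u v u∈ v∈))
        (λ u v u∈ v∈ → walk-map (proj₁ ∘ R₂⊆) id (B.conn (μ i) u v u∈ v∈))
        (t∈ i) (s∈ (μ i)) (link i)
    ; disjoint = λ {i} {j} {z} z∈i z∈j → clash (x∈p∪q⁻ (A.path i) _ z∈i) (x∈p∪q⁻ (A.path j) _ z∈j)
    ; source = λ i → let z , z∈ , z∈X = A.source i in z , p⊆p∪q _ z∈ , z∈X
    ; target = λ i → let z , z∈ , z∈Y = B.target (μ i) in z , q⊆p∪q (A.path i) _ z∈ , z∈Y
    }
    where
    module A = Linkage L₁
    module B = Linkage L₂
    ∣S∪⁅⁆∣≤k : ∀ z → ∣ (P ∩ Q) ∪ ⁅ z ⁆ ∣ ≤ k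
    ∣S∪⁅⁆∣≤k z = ≤-trans (∣p∣≤∣q∣+∣r∣ (x∈p∪q⁻ (P ∩ Q) ⁅ z ⁆))
      (subst (_≤ k) (trans (+-comm 1 _) (cong (∣ P ∩ Q ∣ +_) (sym (∣⁅x⁆∣≡1 z)))) order)
    t s : Fin k → Fin n
    t = proj₁ ∘ A.target
    s = proj₁ ∘ B.source
    t∈ : ∀ i → t i ∈ A.path i
    t∈ = proj₁ ∘ proj₂ ∘ A.target
    s∈ : ∀ i → s i ∈ B.path i
    s∈ = proj₁ ∘ proj₂ ∘ B.source
    path⊆P : ∀ {i z} → z ∈ A.path i → z ∈ P
    path⊆P {i} {z} z∈ = let a , a∈ , a∈X = A.source i in
      walk-invariant (λ r _ → proj₂ (proj₂ (R₁⊆ r))) (A.conn i a z a∈ z∈) (X⊆P a∈X)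
    path⊆Q : ∀ {i z} → z ∈ B.path i → z ∈ Q
    path⊆Q {i} {z} z∈ = let b , b∈ , b∈Y = B.target i in
      walk-invariant (λ r _ → proj₂ (proj₂ (R₂⊆ r))) (B.conn i b z b∈ z∈) (Y⊆Q b∈Y)
    match : ∀ i → ∃[ j ] ((t i ≡ s j × t i ∈ P ∩ Q) ⊎ (t i ≡ x × s j ≡ y))
    match i with x∈p∪q⁻ (P ∩ Q) ⁅ x ⁆ (proj₂ (proj₂ (A.target i)))
    ... | inj₁ ti∈ = let j , eq = proj₂ (proj₂ (B.sources (∣S∪⁅⁆∣≤k y))) (p⊆p∪q ⁅ y ⁆ ti∈) in
      j , inj₁ (sym eq , ti∈)
    ... | inj₂ ti∈ = let j , eq = proj₂ (proj₂ (B.sources (∣S∪⁅⁆∣≤k y))) (q⊆p∪q (P ∩ Q) _ (x∈⁅x⁆ y)) in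
      j , inj₂ (x∈⁅y⁆⇒x≡y x ti∈ , eq)
    μ : Fin k → Fin k
    μ = proj₁ ∘ match
    link : ∀ i → t i ≡ s (μ i) ⊎ R (t i) (s (μ i))
    link i with match i
    ... | _ , inj₁ (eq , _) = inj₁ eq
    ... | _ , inj₂ (ti , sj) = inj₂ (subst₂ R (sym ti) (sym sj) xy)
    μ-injective : ∀ {i j} → μ i ≡ μ j → i ≡ j
    μ-injective {i} {j} eq with match i | match j
    μ-injective refl | _ , inj₁ (ti , _) | _ , inj₁ (tj , _) = A.target-injective (trans ti (sym tj))
    μ-injective refl | _ , inj₂ (ti , _) | _ , inj₂ (tj , _) = A.target-injective (trans ti (sym tj))
    μ-injective refl | _ , inj₁ (ti , ti∈) | _ , inj₂ (_ , sj) =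
      ⊥-elim (y∉P (subst (_∈ P) (trans ti sj) (proj₁ (x∈p∩q⁻ P Q ti∈))))
    μ-injective refl | _ , inj₂ (_ , si) | _ , inj₁ (tj , tj∈) =
      ⊥-elim (y∉P (subst (_∈ P) (trans tj si) (proj₁ (x∈p∩q⁻ P Q tj∈))))
    -- A vertex common to both linkages lies in `P ∩ Q`, hence is the end of one path and the start
    -- of the other.
    meet : ∀ {i j z} → z ∈ A.path i → z ∈ B.path (μ j) → i ≡ j
    meet {i} {j} {z} z∈A z∈B = go (match j) refl
      where
      z∈S : z ∈ P ∩ Q
      z∈S = x∈p∩q⁺ (path⊆P z∈A , path⊆Q z∈B)
      z≡t : z ≡ t i
      z≡t = A.at-target (∣S∪⁅⁆∣≤k x) z∈A (p⊆p∪q ⁅ x ⁆ z∈S)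
      z≡s : z ≡ s (μ j)
      z≡s = B.at-source (∣S∪⁅⁆∣≤k y) z∈B (p⊆p∪q ⁅ y ⁆ z∈S)
      go : (m : ∃[ l ] ((t j ≡ s l × t j ∈ P ∩ Q) ⊎ (t j ≡ x × s l ≡ y))) → proj₁ m ≡ μ j → i ≡ j
      go (_ , inj₁ (tj , _)) refl = A.target-injective (trans (sym z≡t) (trans z≡s (sym tj)))
      go (_ , inj₂ (_ , sj)) refl =
        ⊥-elim (y∉P (subst (_∈ P) (trans z≡s sj) (path⊆P z∈A)))
    clash : ∀ {i j z} → z ∈ A.path i ⊎ z ∈ B.path (μ i) → z ∈ A.path j ⊎ z ∈ B.path (μ j) → i ≡ j
    clash (inj₁ a) (inj₁ b) = A.disjoint a b
    clash (inj₁ a) (inj₂ b) = meet a b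
    clash (inj₂ a) (inj₁ b) = sym (meet b a)
    clash (inj₂ a) (inj₂ b) = μ-injective (B.disjoint a b)

  -- Adding `y` to `P` puts the new edge inside one side. It costs one vertex, which the strict
  -- bound on the order affords.
  separator-Q : ∀ {R X Y k x y} → (S : Separator R X Y k) → let open Separator S in
    x ∈ P → y ∈ Q → suc ∣ P ∩ Q ∣ < k → ∀ {R′} → AddEdge x y R R′ → Separator R′ X Y k
  separator-Q {x = x} {y} (separator P Q sep X⊆P Y⊆Q _) x∈P y∈Q order new = separator (P ∪ ⁅ y ⁆) Q
    (record
      { cover = λ z → [ inj₁ ∘ p⊆p∪q ⁅ y ⁆ , inj₂ ]′ (cover z)
      ; nocross = λ r u∉Q v∉P′ → go (new r) u∉Q v∉P′ })
    (p⊆p∪q ⁅ y ⁆ ∘ X⊆P) Y⊆Q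
    (<-≤-trans (s≤s (subst (∣ (P ∪ ⁅ y ⁆) ∩ Q ∣ ≤_) (trans (cong (∣ P ∩ Q ∣ +_) (∣⁅x⁆∣≡1 y)) (+-comm _ 1))
      (∣p∣≤∣q∣+∣r∣ λ {z} z∈ → let z∈P′ , z∈Q = x∈p∩q⁻ (P ∪ ⁅ y ⁆) Q z∈ in
        [ (λ z∈P → inj₁ (x∈p∩q⁺ (z∈P , z∈Q))) , inj₂ ]′ (x∈p∪q⁻ P ⁅ y ⁆ z∈P′)))) order)
    where
    open Separation sep
    go : ∀ {u v} → _ → u ∉ Q → v ∉ P ∪ ⁅ y ⁆ → ⊥
    go (inj₁ r) u∉Q v∉P′ = nocross r u∉Q (v∉P′ ∘ p⊆p∪q ⁅ y ⁆)
    go (inj₂ (inj₁ (_ , refl))) _ v∉P′ = v∉P′ (q⊆p∪q P _ (x∈⁅x⁆ y))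
    go (inj₂ (inj₂ (refl , _))) u∉Q _ = u∉Q y∈Q

  -- The overlap stays inside `P′ ∩ Q′`: a vertex of `P ∩ P′` that is in `Q` lies in `P ∩ Q`, hence
  -- in `Q′`. The new edge is harmless because `x` lies in `Q′` and `y` in `Q`.
  separator-P : ∀ {R R′ R₁ X Y P Q x y k} → Separation R P Q → y ∈ Q → X ⊆ P → Y ⊆ Q →
    AddEdge x y R R′ → (∀ {u v} → R u v → u ∈ P → v ∈ P → R₁ u v) →
    Separator R₁ X ((P ∩ Q) ∪ ⁅ x ⁆) k → Separator R′ X Y k
  separator-P {R} {P = P} {Q} {x} {y} sep y∈Q X⊆P Y⊆Q new keep (separator P′ Q′ sep′ X⊆P′ T⊆Q′ order) =
    separator (P ∩ P′) (Q ∪ Q′)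
      (record { cover = cover″ ; nocross = λ r → go (new r) })
      (λ x∈ → x∈p∩q⁺ (X⊆P x∈ , X⊆P′ x∈)) (p⊆p∪q Q′ ∘ Y⊆Q)
      (≤-<-trans (p⊆q⇒∣p∣≤∣q∣ λ {z} z∈ →
        let z∈PP′ , z∈QQ′ = x∈p∩q⁻ (P ∩ P′) _ z∈ ; z∈P , z∈P′ = x∈p∩q⁻ P P′ z∈PP′ in
        x∈p∩q⁺ (z∈P′ , [ (λ z∈Q → T⊆Q′ (p⊆p∪q ⁅ x ⁆ (x∈p∩q⁺ (z∈P , z∈Q)))) , id ]′ (x∈p∪q⁻ Q Q′ z∈QQ′))) order)
    where
    open Separation sep
    module S′ = Separation sep′
    cover″ : ∀ z → z ∈ P ∩ P′ ⊎ z ∈ Q ∪ Q′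
    cover″ z with cover z | S′.cover z
    ... | inj₂ z∈ | _ = inj₂ (p⊆p∪q Q′ z∈)
    ... | inj₁ _ | inj₂ z∈ = inj₂ (q⊆p∪q Q Q′ z∈)
    ... | inj₁ z∈ | inj₁ z∈′ = inj₁ (x∈p∩q⁺ (z∈ , z∈′))
    go : ∀ {u v} → R u v ⊎ (u ≡ x × v ≡ y) ⊎ (u ≡ y × v ≡ x) → u ∉ Q ∪ Q′ → v ∉ P ∩ P′ → ⊥
    go {u} {v} (inj₁ r) u∉ v∉ with v ∈? P
    ... | no v∉P = nocross r (u∉ ∘ p⊆p∪q Q′) v∉P
    ... | yes v∈P = S′.nocross (keep r (∉Q⇒∈P (u∉ ∘ p⊆p∪q Q′)) v∈P) (u∉ ∘ q⊆p∪q Q Q′)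
      (λ v∈P′ → v∉ (x∈p∩q⁺ (v∈P , v∈P′)))
    go (inj₂ (inj₁ (refl , _))) u∉ _ = u∉ (q⊆p∪q Q Q′ (T⊆Q′ (q⊆p∪q (P ∩ Q) _ (x∈⁅x⁆ x))))
    go (inj₂ (inj₂ (refl , _))) u∉ _ = u∉ (p⊆p∪q Q′ y∈Q)

  Linkage-map : ∀ {R R′ : Fin n → Fin n → Set} {X Y k} →
    (∀ {u v} → R u v → R′ u v) → Linkage R X Y k → Linkage R′ X Y k
  Linkage-map R⊆ L = record
    { path = path ; conn = λ i u v u∈ v∈ → walk-map R⊆ id (conn i u v u∈ v∈)
    ; disjoint = disjoint ; source = source ; target = target }
    where open Linkage L

  Separation-sym : ∀ {R : Fin n → Fin n → Set} {P Q} → (∀ {u v} → R u v → R v u) →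
    Separation R P Q → Separation R Q P
  Separation-sym R-sym S = record
    { cover = λ x → [ inj₂ , inj₁ ]′ (cover x) ; nocross = λ r u∉ v∉ → nocross (R-sym r) v∉ u∉ }
    where open Separation S

  Separator-sym : ∀ {R X Y k} → (∀ {u v} → R u v → R v u) → Separator R X Y k → Separator R Y X k
  Separator-sym R-sym (separator P Q sep X⊆P Y⊆Q order) =
    separator Q P (Separation-sym R-sym sep) Y⊆Q X⊆P (subst (λ S → ∣ S ∣ < _) (∩-comm P Q) order)

  Linked : (R : Fin n → Fin n → Set) (X Y : Subset n) (k : ℕ) → Set
  Linked R X Y k = Linkage R X Y k ⊎ Separator R X Y k

  -- Göring's proof.  A small separator of E that the edge xy crosses is either small enough to absorb y,
  -- or it has size k - 1; then X is linked to S + x and S + y to Y, and the two linkages are glued along S and xy.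
  menger-crossing : ∀ {m E x y X Y k} →
    (∀ {E′} → length E′ ≤ m → ∀ X Y → Linked (Joins E′) X Y k) → length E ≤ m →
    (T : Separator (Joins E) X Y k) → let open Separator T in x ∉ Q → y ∉ P →
    ∀ {R} → (∀ {u v} → R u v → R v u) → (∀ {u v} → Joins E u v → R u v) → R x y → AddEdge x y (Joins E) R →
    Linked R X Y k
  menger-crossing {m} {E} {x} {y} {X} {Y} {k} rec E≤m T@(separator P Q sep X⊆P Y⊆Q order) x∉Q y∉P R-sym E⊆R xy new
    with suc ∣ P ∩ Q ∣ <? k
  ... | yes lt = inj₂ (separator-Q T (Separation.∉Q⇒∈P sep x∉Q) (Separation.∉P⇒∈Q sep y∉P) lt new)
  ... | no _ with rec {restrict P E} (≤-trans (length-filter (within? P) E) E≤m) X ((P ∩ Q) ∪ ⁅ x ⁆)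
                | rec {restrict Q E} (≤-trans (length-filter (within? Q) E) E≤m) ((P ∩ Q) ∪ ⁅ y ⁆) Y
  ... | inj₂ T₁ | _ = inj₂ (separator-P sep (Separation.∉P⇒∈Q sep y∉P) X⊆P Y⊆Q new (restrict⁺ P) T₁)
  ... | inj₁ _ | inj₂ T₂ = inj₂ (Separator-sym R-sym
          (separator-P (Separation-sym Joins-sym sep) (Separation.∉Q⇒∈P sep x∉Q) Y⊆Q X⊆P
            (λ r → [ inj₁ , [ inj₂ ∘ inj₂ , inj₂ ∘ inj₁ ]′ ]′ (new r)) (restrict⁺ Q)
            (subst (λ S → Separator _ Y (S ∪ ⁅ y ⁆) k) (∩-comm P Q) (Separator-sym Joins-sym T₂))))
  ... | inj₁ L₁ | inj₁ L₂ = inj₁ (glue R-sym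
          (λ r → let e , uv = restrict⁻ P r in E⊆R e , uv) (λ r → let e , uv = restrict⁻ Q r in E⊆R e , uv)
          xy x∉Q y∉P X⊆P Y⊆Q order L₁ L₂)

  menger-Joins : ∀ m E → length E ≤ m → ∀ X Y k → Linked (Joins E) X Y k
  menger-Joins m [] _ X Y k with ∣ X ∩ Y ∣ <? k
  -- Without edges the complement of `X` can join the side of `Y`, leaving the overlap `X ∩ Y`.
  ... | yes lt = inj₂ (separator X (Y ∪ ∁ X)
          (record
            { cover = λ x → [ inj₁ , inj₂ ∘ q⊆p∪q Y (∁ X) ]′ (∈⊎∈∁ x)
            ; nocross = λ { (inj₁ ()) ; (inj₂ ()) } })
          id (p⊆p∪q (∁ X))
          (≤-<-trans (p⊆q⇒∣p∣≤∣q∣ λ {x} x∈ → let x∈X , x∈′ = x∈p∩q⁻ X _ x∈ in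
            [ (λ x∈Y → x∈p∩q⁺ (x∈X , x∈Y)) , (λ x∈∁ → ⊥-elim (x∈∁p⇒x∉p x∈∁ x∈X)) ]′ (x∈p∪q⁻ Y (∁ X) x∈′)) lt))
    where
    ∈⊎∈∁ : ∀ x → x ∈ X ⊎ x ∈ ∁ X
    ∈⊎∈∁ x with x ∈? X
    ... | yes x∈ = inj₁ x∈
    ... | no x∉ = inj₂ (x∉p⇒x∈∁p x∉)
  ... | no ≮k = inj₁ (record
    { path = ⁅_⁆ ∘ f ; conn = λ i → conn-⁅⁆
    ; disjoint = λ {i} {j} x∈i x∈j → f-inj (trans (sym (x∈⁅y⁆⇒x≡y _ x∈i)) (x∈⁅y⁆⇒x≡y _ x∈j))
    ; source = λ i → f i , x∈⁅x⁆ _ , proj₁ (x∈p∩q⁻ X Y (f∈ i))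
    ; target = λ i → f i , x∈⁅x⁆ _ , proj₂ (x∈p∩q⁻ X Y (f∈ i)) })
    where
    e = enumerate (X ∩ Y)
    f : Fin k → Fin n
    f i = proj₁ e (inject≤ i (≮⇒≥ ≮k))
    f-inj : ∀ {i j} → f i ≡ f j → i ≡ j
    f-inj eq = inject≤-injective _ _ _ _ (proj₁ (proj₂ e) eq)
    f∈ : ∀ i → f i ∈ X ∩ Y
    f∈ i = proj₁ (proj₂ (proj₂ e)) _
  menger-Joins (suc m) (e@(x , y) ∷ E) (s≤s E≤m) X Y k with menger-Joins m E E≤m X Y k
  ... | inj₁ L = inj₁ (Linkage-map Joins-there L)
  ... | inj₂ T@(separator P Q sep X⊆P Y⊆Q order) = go
    where
    open Separation sep
    new : AddEdge x y (Joins E) (Joins (e ∷ E))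
    new (inj₁ (Any.here refl)) = inj₂ (inj₁ (refl , refl))
    new (inj₁ (Any.there r)) = inj₁ (inj₁ r)
    new (inj₂ (Any.here refl)) = inj₂ (inj₂ (refl , refl))
    new (inj₂ (Any.there r)) = inj₁ (inj₂ r)
    crossing : ∀ {x′ y′} → x′ ∉ Q → y′ ∉ P → Joins (e ∷ E) x′ y′ → AddEdge x′ y′ (Joins E) (Joins (e ∷ E)) →
      Linked (Joins (e ∷ E)) X Y k
    crossing x∉ y∉ = menger-crossing (λ E′≤m X Y → menger-Joins m _ E′≤m X Y k) E≤m T x∉ y∉ Joins-sym Joins-there
    nocross′ : ∀ {u v} → Joins E u v ⊎ (u ≡ x × v ≡ y) ⊎ (u ≡ y × v ≡ x) →
      ¬ (x ∉ Q × y ∉ P) → ¬ (y ∉ Q × x ∉ P) → u ∉ Q → v ∉ P → ⊥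
    nocross′ (inj₁ r) _ _ u∉ v∉ = nocross r u∉ v∉
    nocross′ (inj₂ (inj₁ (refl , refl))) ¬xy _ u∉ v∉ = ¬xy (u∉ , v∉)
    nocross′ (inj₂ (inj₂ (refl , refl))) _ ¬yx u∉ v∉ = ¬yx (u∉ , v∉)
    go : Linked (Joins (e ∷ E)) X Y k
    go with ¬? (x ∈? Q) ×-dec ¬? (y ∈? P) | ¬? (y ∈? Q) ×-dec ¬? (x ∈? P)
    ... | yes (x∉ , y∉) | _ = crossing x∉ y∉ (inj₁ (Any.here refl)) new
    ... | no _ | yes (y∉ , x∉) = crossing y∉ x∉ (inj₂ (Any.here refl))
            (λ r → [ inj₁ , [ inj₂ ∘ inj₂ , inj₂ ∘ inj₁ ]′ ]′ (new r))
    ... | no ¬xy | no ¬yx = inj₂ (separator P Q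
            (record { cover = cover ; nocross = λ r → nocross′ (new r) ¬xy ¬yx }) X⊆P Y⊆Q order)

  menger : ∀ {R : Fin n → Fin n → Set} → (∀ u v → Dec (R u v)) → (∀ {u v} → R u v → R v u) →
    ∀ X Y k → Linked R X Y k
  menger {R} R? R-sym X Y k = [ inj₁ ∘ Linkage-map Joins⇒R , inj₂ ∘ convert ]′ (menger-Joins _ E ≤-refl X Y k)
    where
    RE? : ∀ (e : Fin n × Fin n) → Dec (R (proj₁ e) (proj₂ e))
    RE? (u , v) = R? u v
    pairs E : Edges
    pairs = cartesianProduct (allFin n) (allFin n)
    E = filter RE? pairs
    Joins⇒R : ∀ {u v} → Joins E u v → R u v
    Joins⇒R (inj₁ e) = proj₂ (∈-filter⁻ RE? {xs = pairs} e)
    Joins⇒R (inj₂ e) = R-sym (proj₂ (∈-filter⁻ RE? {xs = pairs} e))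
    R⇒Joins : ∀ {u v} → R u v → Joins E u v
    R⇒Joins r = inj₁ (∈-filter⁺ RE? (∈-cartesianProduct⁺ (∈-allFin _) (∈-allFin _)) r)
    convert : Separator (Joins E) X Y k → Separator R X Y k
    convert (separator P Q sep X⊆P Y⊆Q order) =
      separator P Q (record { cover = cover ; nocross = nocross ∘ R⇒Joins }) X⊆P Y⊆Q order
      where open Separation sep

-- Rooted forests in front of a well-linked set

Touch : {V : Set} → (V → V → Set) → (V → Set) → (V → Set) → Set
Touch R S T = ∃[ x ] ∃[ y ] (S x × T y × R x y)

-- Every vertex is a leaf when it is added, or starts a new tree, and the newest has index zero.
-- This is the order in which branch sets are grown.
data Forest : ℕ → Set where
  nil : Forest 0
  add : ∀ {i} → Forest i → Maybe (Fin i) → Forest (suc i)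

data FEdge : ∀ {i} → Forest i → Fin i → Fin i → Set where
  new : ∀ {i} {F : Forest i} {p} → FEdge (add F (just p)) fzero (fsuc p)
  old : ∀ {i} {F : Forest i} {q a b} → FEdge F a b → FEdge (add F q) (fsuc a) (fsuc b)

nonempty⇒0<∣p∣ : ∀ {n} {p : Subset n} {x} → x ∈ p → 0 < ∣ p ∣
nonempty⇒0<∣p∣ x∈ = <-≤-trans (s≤s z≤n) (x∈p⇒∣p-x∣<∣p∣ x∈)

∣p∣<∣q∣⇒∃ : ∀ {n} {p q : Subset n} → ∣ p ∣ < ∣ q ∣ → ∃[ x ] (x ∈ q × x ∉ p)
∣p∣<∣q∣⇒∃ {p = p} {q} lt with any? (λ x → (x ∈? q) ×-dec ¬? (x ∈? p))
... | yes found = found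
... | no none = ⊥-elim (<⇒≱ lt (p⊆q⇒∣p∣≤∣q∣ sub))
  where
  sub : q ⊆ p
  sub {x} x∈ with x ∈? p
  ... | yes x∈p = x∈p
  ... | no x∉p = ⊥-elim (none (x , x∈ , x∉p))

separation? : ∀ {n} {R : Fin n → Fin n → Set} → (∀ u v → Dec (R u v)) → ∀ P Q → Dec (Separation R P Q)
separation? R? P Q = map′
  (λ (c , nc) → record { cover = c ; nocross = λ r u∉ v∉ → nc _ _ r (u∉ , v∉) })
  (λ S → let open Separation S in cover , λ u v r (u∉ , v∉) → nocross r u∉ v∉)
  (all? (λ x → (x ∈? P) ⊎-dec (x ∈? Q)) ×-dec
   all? (λ u → all? (λ v → R? u v →-dec ¬? (¬? (u ∈? Q) ×-dec ¬? (v ∈? P)))))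

-- Fewer than `N` vertices of `Z` lie outside `B`; the additive form avoids truncated subtraction
-- and can be summed.
Big : ∀ {n} → Subset n → ℕ → Subset n → Set
Big Z N B = ∣ Z ∣ < ∣ Z ∩ B ∣ + N

-- The sides B that are Big form a tangle of order N.
WellLinked : ∀ {n} → (Fin n → Fin n → Set) → Subset n → ℕ → Set
WellLinked R Z N = ∀ P Q → Separation R P Q → ∣ P ∩ Q ∣ ≤ N → Big Z N P ⊎ Big Z N Q

module Grow {n : ℕ} {R : Fin n → Fin n → Set} (R? : ∀ u v → Dec (R u v)) (R-sym : ∀ {u v} → R u v → R v u)
  {Z : Subset n} {N : ℕ} (Z-large : 5 * N ≤ ∣ Z ∣) (linked : WellLinked R Z N) where

  big-mono : ∀ {B B′} → B′ ⊆ B → Big Z N B′ → Big Z N B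
  big-mono {B} {B′} B′⊆B lt = <-≤-trans lt (+-monoˡ-≤ N (p⊆q⇒∣p∣≤∣q∣ λ {x} x∈ →
    let x∈Z , x∈B′ = x∈p∩q⁻ Z B′ x∈ in x∈p∩q⁺ (x∈Z , B′⊆B x∈B′)))

  ∣Z∩p∣+∣Z∩q∣≤ : ∀ p q → ∣ Z ∩ p ∣ + ∣ Z ∩ q ∣ ≤ ∣ Z ∣ + ∣ Z ∩ (p ∩ q) ∣
  ∣Z∩p∣+∣Z∩q∣≤ p q = ∣p∣+∣q∣≤ (p∩q⊆p Z p) (p∩q⊆p Z q) λ {x} x∈₁ x∈₂ →
    let x∈Z , x∈p = x∈p∩q⁻ Z p x∈₁ in x∈p∩q⁺ (x∈Z , x∈p∩q⁺ (x∈p , proj₂ (x∈p∩q⁻ Z q x∈₂)))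

  -- Three big sides together miss fewer than `3 N` of the at least `5 N` vertices of `Z`, so more
  -- than `2 N` are common to all three.
  ¬big³ : ∀ {p q r} → Big Z N p → Big Z N q → Big Z N r → ∣ (p ∩ q) ∩ r ∣ ≤ 2 * N → ⊥
  ¬big³ {p} {q} {r} bp bq br small = <⇒≱ lower upper
    where
    z = ∣ Z ∣
    a b c pq pqr : ℕ
    a = ∣ Z ∩ p ∣
    b = ∣ Z ∩ q ∣
    c = ∣ Z ∩ r ∣
    pq = ∣ Z ∩ (p ∩ q) ∣
    pqr = ∣ Z ∩ ((p ∩ q) ∩ r) ∣
    open ≤-Reasoning
    lower : z + z + z < (a + N) + (b + N) + (c + N)
    lower = +-mono-< (+-mono-< bp bq) br
    upper : (a + N) + (b + N) + (c + N) ≤ z + z + z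
    upper = begin
      (a + N) + (b + N) + (c + N)   ≡⟨ solve 4 (λ a b c N → (a :+ N) :+ (b :+ N) :+ (c :+ N) := (a :+ b) :+ c :+ con 3 :* N) refl a b c N ⟩
      (a + b) + c + 3 * N           ≤⟨ +-monoˡ-≤ (3 * N) (+-monoˡ-≤ c (∣Z∩p∣+∣Z∩q∣≤ p q)) ⟩
      (z + pq) + c + 3 * N          ≡⟨ cong (_+ 3 * N) (+-assoc z pq c) ⟩
      z + (pq + c) + 3 * N          ≤⟨ +-monoˡ-≤ (3 * N) (+-monoʳ-≤ z (∣Z∩p∣+∣Z∩q∣≤ (p ∩ q) r)) ⟩
      z + (z + pqr) + 3 * N         ≤⟨ +-monoˡ-≤ (3 * N) (+-monoʳ-≤ z (+-monoʳ-≤ z (≤-trans (∣p∩q∣≤∣q∣ Z _) small))) ⟩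
      z + (z + 2 * N) + 3 * N       ≡⟨ solve 2 (λ z N → z :+ (z :+ con 2 :* N) :+ con 3 :* N := z :+ z :+ con 5 :* N) refl z N ⟩
      z + z + 5 * N                 ≤⟨ +-monoʳ-≤ (z + z) Z-large ⟩
      z + z + z                     ∎

  -- `A ∩ B` contains the `i` distinct roots and has at most `i` vertices, so it consists of the
  -- roots. A branch set therefore meets `B` in its root alone.
  record State {i : ℕ} (F : Forest i) (A B : Subset n) : Set where
    field
      sep      : Separation R A B
      order    : ∣ A ∩ B ∣ ≤ i
      big      : Big Z N B
      branch   : Fin i → Subset n
      root     : Fin i → Fin n
      root∈    : ∀ j → root j ∈ branch j
      root∈A∩B : ∀ j → root j ∈ A ∩ B
      branch⊆A : ∀ j → branch j ⊆ A
      conn     : ∀ j → Conn R (_∈ branch j)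
      disjoint : ∀ {j k x} → x ∈ branch j → x ∈ branch k → j ≡ k
      edge     : ∀ {j k} → FEdge F j k → Touch R (_∈ branch j) (_∈ branch k)

    root-injective : Injective _≡_ _≡_ root
    root-injective {j} {k} eq = disjoint (root∈ j) (subst (_∈ branch k) (sym eq) (root∈ k))

    roots : Enumerates root (A ∩ B)
    roots = injective⇒Enumerates root-injective root∈A∩B order

    at-root : ∀ {j x} → x ∈ branch j → x ∈ B → x ≡ root j
    at-root {j} x∈ x∈B with proj₂ (proj₂ roots) (x∈p∩q⁺ (branch⊆A j x∈ , x∈B))
    ... | k , refl = cong root (disjoint (root∈ k) x∈)

  Improvement : ℕ → Subset n → Subset n → Subset n → Subset n → Set
  Improvement i A B A′ B′ = Separation R A′ B′ × A ⊆ A′ × B′ ⊆ B × ∣ A′ ∩ B′ ∣ < i × Big Z N B′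

  Tight : ℕ → Subset n → Subset n → Set
  Tight i A B = ∀ A′ B′ → ¬ Improvement i A B A′ B′

  improvement? : ∀ i A B → Dec (∃[ A′ ] ∃[ B′ ] Improvement i A B A′ B′)
  improvement? i A B = anySubset? λ A′ → anySubset? λ B′ →
    separation? R? A′ B′ ×-dec (A ⊆? A′) ×-dec (B′ ⊆? B) ×-dec (∣ A′ ∩ B′ ∣ <? i) ×-dec
    (∣ Z ∣ <? ∣ Z ∩ B′ ∣ + N)

  -- Menger's theorem is applied between the two overlaps, in the region `A′ ∩ B`. If `i` paths
  -- exist, they prolong the branch sets and carry the roots to `A′ ∩ B′`; a smaller separator
  -- contradicts tightness.
  reroot : ∀ {i} {F : Forest i} {A B A′ B′} → State F A B → Tight i A B →
    Improvement (suc i) A B A′ B′ → State F A′ B′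
  reroot {i} {F} {A} {B} {A′} {B′} st tight (sep′ , A⊆A′ , B′⊆B , s≤s order′ , big′) =
    [ move , ⊥-elim ∘ no-separator ]′ (menger R₁? R₁-sym (A ∩ B) (A′ ∩ B′) i)
    where
    open State st
    open Separation sep
    module S′ = Separation sep′
    C = A′ ∩ B
    R₁ : Fin n → Fin n → Set
    R₁ u v = R u v × u ∈ C × v ∈ C
    R₁? : ∀ u v → Dec (R₁ u v)
    R₁? u v = R? u v ×-dec (u ∈? C) ×-dec (v ∈? C)
    R₁-sym : ∀ {u v} → R₁ u v → R₁ v u
    R₁-sym (r , u∈ , v∈) = R-sym r , v∈ , u∈

    no-separator : Separator R₁ (A ∩ B) (A′ ∩ B′) i → ⊥
    -- Uncrossing: the separator is inserted between the two separations. The new overlap lies in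
    -- `P ∩ Q`, and the far side is big because it contains `B′`.
    no-separator (separator P Q sep₁ X⊆P Y⊆Q order₁) = tight A″ B″
      ( record { cover = cover″ ; nocross = nocross″ } , p⊆p∪q (P ∩ A′)
      , (λ x∈ → [ proj₁ ∘ x∈p∩q⁻ B Q , B′⊆B ]′ (x∈p∪q⁻ (B ∩ Q) B′ x∈))
      , ≤-<-trans (p⊆q⇒∣p∣≤∣q∣ λ x∈ → let a , b = x∈p∩q⁻ A″ B″ x∈ in
          meet (x∈p∪q⁻ A (P ∩ A′) a) (x∈p∪q⁻ (B ∩ Q) B′ b)) order₁
      , big-mono (q⊆p∪q (B ∩ Q) B′) big′ )
      where
      module S₁ = Separation sep₁
      A″ = A ∪ (P ∩ A′)
      B″ = (B ∩ Q) ∪ B′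
      meet : ∀ {x} → x ∈ A ⊎ x ∈ P ∩ A′ → x ∈ B ∩ Q ⊎ x ∈ B′ → x ∈ P ∩ Q
      meet (inj₁ x∈A) (inj₁ x∈BQ) = let x∈B , x∈Q = x∈p∩q⁻ B Q x∈BQ in
        x∈p∩q⁺ (X⊆P (x∈p∩q⁺ (x∈A , x∈B)) , x∈Q)
      meet (inj₁ x∈A) (inj₂ x∈B′) = x∈p∩q⁺ (X⊆P (x∈p∩q⁺ (x∈A , B′⊆B x∈B′)) , Y⊆Q (x∈p∩q⁺ (A⊆A′ x∈A , x∈B′)))
      meet (inj₂ x∈PA′) (inj₁ x∈BQ) = x∈p∩q⁺ (proj₁ (x∈p∩q⁻ P A′ x∈PA′) , proj₂ (x∈p∩q⁻ B Q x∈BQ))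
      meet (inj₂ x∈PA′) (inj₂ x∈B′) = let x∈P , x∈A′ = x∈p∩q⁻ P A′ x∈PA′ in
        x∈p∩q⁺ (x∈P , Y⊆Q (x∈p∩q⁺ (x∈A′ , x∈B′)))
      cover″ : ∀ x → x ∈ A″ ⊎ x ∈ B″
      cover″ x with cover x | S′.cover x | S₁.cover x
      ... | inj₁ x∈A | _ | _ = inj₁ (p⊆p∪q (P ∩ A′) x∈A)
      ... | inj₂ _ | inj₂ x∈B′ | _ = inj₂ (q⊆p∪q (B ∩ Q) B′ x∈B′)
      ... | inj₂ _ | inj₁ x∈A′ | inj₁ x∈P = inj₁ (q⊆p∪q A (P ∩ A′) (x∈p∩q⁺ (x∈P , x∈A′)))
      ... | inj₂ x∈B | inj₁ _ | inj₂ x∈Q = inj₂ (p⊆p∪q B′ (x∈p∩q⁺ (x∈B , x∈Q)))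
      nocross″ : ∀ {u v} → R u v → u ∉ B″ → v ∉ A″ → ⊥
      nocross″ {u} {v} r u∉ v∉ with u ∈? B | v ∈? A′
      ... | no u∉B | _ = nocross r u∉B (v∉ ∘ p⊆p∪q (P ∩ A′))
      ... | yes _ | no v∉A′ = S′.nocross r (u∉ ∘ q⊆p∪q (B ∩ Q) B′) v∉A′
      ... | yes u∈B | yes v∈A′ = S₁.nocross
        (r , x∈p∩q⁺ (S′.∉Q⇒∈P (u∉ ∘ q⊆p∪q (B ∩ Q) B′) , u∈B)
           , x∈p∩q⁺ (v∈A′ , ∉P⇒∈Q (v∉ ∘ p⊆p∪q (P ∩ A′))))
        (λ u∈Q → u∉ (p⊆p∪q B′ (x∈p∩q⁺ (u∈B , u∈Q))))
        (λ v∈P → v∉ (q⊆p∪q A (P ∩ A′) (x∈p∩q⁺ (v∈P , v∈A′))))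

    move : Linkage R₁ (A ∩ B) (A′ ∩ B′) i → State F A′ B′
    move L = record
      { sep = sep′ ; order = order′ ; big = big′
      ; branch = λ j → branch j ∪ path (ι j)
      ; root = λ j → proj₁ (target (ι j))
      ; root∈ = λ j → q⊆p∪q (branch j) _ (proj₁ (proj₂ (target (ι j))))
      ; root∈A∩B = λ j → proj₂ (proj₂ (target (ι j)))
      ; branch⊆A = λ j x∈ → [ A⊆A′ ∘ branch⊆A j , (λ x∈p → proj₁ (x∈p∩q⁻ A′ B (path⊆C x∈p))) ]′ (x∈p∪q⁻ _ _ x∈)
      ; conn = λ j → conn-∪ R-sym (conn j) (λ u v u∈ v∈ → walk-map proj₁ id (ℓ.conn (ι j) u v u∈ v∈))
          (root∈ j) (ι∈ j) (inj₁ refl)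
      ; disjoint = λ x∈j x∈k → clash (x∈p∪q⁻ _ _ x∈j) (x∈p∪q⁻ _ _ x∈k)
      ; edge = λ e → let x , y , x∈ , y∈ , r = edge e in x , y , p⊆p∪q _ x∈ , p⊆p∪q _ y∈ , r
      }
      where
      module ℓ = Linkage L
      open ℓ using (path; source; target)
      matched : ∀ j → ∃[ l ] proj₁ (source l) ≡ root j
      matched j = proj₂ (proj₂ (ℓ.sources order)) (root∈A∩B j)
      ι : Fin i → Fin i
      ι = proj₁ ∘ matched
      ι∈ : ∀ j → root j ∈ path (ι j)
      ι∈ j = subst (_∈ path (ι j)) (proj₂ (matched j)) (proj₁ (proj₂ (source (ι j))))
      ι-injective : ∀ {j k} → ι j ≡ ι k → j ≡ k
      ι-injective {j} {k} eq = root-injective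
        (trans (sym (proj₂ (matched j))) (trans (cong (proj₁ ∘ source) eq) (proj₂ (matched k))))
      path⊆C : ∀ {l x} → x ∈ path l → x ∈ C
      path⊆C {l} {x} x∈ = let a , a∈ , a∈X = source l ; a∈A , a∈B = x∈p∩q⁻ A B a∈X in
        walk-invariant (λ r _ → proj₂ (proj₂ r)) (ℓ.conn l a x a∈ x∈) (x∈p∩q⁺ (A⊆A′ a∈A , a∈B))
      -- The paths run inside `B`, where a branch set has only its root, and each root lies only on
      -- the path that starts there.
      meet : ∀ {j k x} → x ∈ branch j → x ∈ path (ι k) → j ≡ k
      meet {j} {k} {x} x∈j x∈k = root-injective (trans (sym x≡j) x≡k)
        where
        x∈B : x ∈ B
        x∈B = proj₂ (x∈p∩q⁻ A′ B (path⊆C x∈k))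
        x≡j : x ≡ root j
        x≡j = at-root x∈j x∈B
        x≡k : x ≡ root k
        x≡k = trans (ℓ.at-source order x∈k (x∈p∩q⁺ (branch⊆A j x∈j , x∈B))) (proj₂ (matched k))
      clash : ∀ {j k x} → x ∈ branch j ⊎ x ∈ path (ι j) → x ∈ branch k ⊎ x ∈ path (ι k) → j ≡ k
      clash (inj₁ a) (inj₁ b) = disjoint a b
      clash (inj₁ a) (inj₂ b) = meet a b
      clash (inj₂ a) (inj₁ b) = sym (meet b a)
      clash (inj₂ a) (inj₂ b) = ι-injective (ℓ.disjoint a b)

  Attached : ∀ {i} → Maybe (Fin i) → (Fin i → Fin n) → Fin n → Set
  Attached nothing root v = Unit
  Attached (just p) root v = R v (root p)

  -- Counting `A` twice reduces this to the case of three sides.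
  ¬bigA : ∀ {A B} → ∣ A ∩ B ∣ ≤ N → Big Z N B → ¬ Big Z N A
  ¬bigA {A} {B} A∩B≤N bigB bigA = ¬big³ bigA bigA bigB (≤-trans
    (p⊆q⇒∣p∣≤∣q∣ λ {x} x∈ → let x∈AA , x∈B = x∈p∩q⁻ (A ∩ A) B x∈ in
      x∈p∩q⁺ (proj₁ (x∈p∩q⁻ A A x∈AA) , x∈B)) (≤-trans A∩B≤N (m≤m+n N _)))

  -- For a new tree, `Z` has more vertices in `B` than `A ∩ B` can hold. For a new leaf, a root
  -- without neighbours outside `A` could be dropped from `B`, and the resulting smaller separation
  -- contradicts tightness.
  new-vertex : ∀ {i} {F : Forest i} {A B} (st : State F A B) → Tight i A B → i ≤ N → (q : Maybe (Fin i)) →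
    ∃[ v ] (v ∉ A × Attached q (State.root st) v)
  new-vertex {i} {F} {A} {B} st tight i≤N nothing =
    let v , v∈ , v∉ = ∣p∣<∣q∣⇒∃ {p = A ∩ B} {Z ∩ B} small ; v∈B = proj₂ (x∈p∩q⁻ Z B v∈) in
    v , (λ v∈A → v∉ (x∈p∩q⁺ (v∈A , v∈B))) , tt
    where
    open State st
    small : ∣ A ∩ B ∣ < ∣ Z ∩ B ∣
    small = ≤-<-trans (≤-trans order i≤N) (+-cancelʳ-< N N (∣ Z ∩ B ∣)
      (≤-<-trans (≤-trans (+-monoʳ-≤ N (m≤m+n N _)) Z-large) big))
  new-vertex {i} {F} {A} {B} st tight i≤N (just p) with any? (λ v → ¬? (v ∈? A) ×-dec R? v (State.root st p))
  ... | yes found = found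
  ... | no none = ⊥-elim (tight A (B - x)
      (sep′ , ⊆-refl , proj₁ ∘ x∈p-y⇒ , <-≤-trans smaller order , bigB-x))
    where
    open State st
    open Separation sep
    x = root p
    x∈A = proj₁ (x∈p∩q⁻ A B (root∈A∩B p))
    x∈p-y⇒ : ∀ {z} → z ∈ B - x → z ∈ B × z ≢ x
    x∈p-y⇒ {z} z∈ = p─q⊆p B ⁅ x ⁆ z∈ , λ { refl → x∉p-x z∈ }
      where
      x∉p-x : ∀ {m} {p : Subset m} {x} → x ∉ p - x
      x∉p-x {p = _ ∷ _} {fzero} ()
      x∉p-x {p = _ ∷ p} {fsuc x} (there x∈) = x∉p-x {p = p} x∈
    sep′ : Separation R A (B - x)
    sep′ = record { cover = cover′ ; nocross = nocross′ }
      where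
      cover′ : ∀ z → z ∈ A ⊎ z ∈ B - x
      cover′ z with cover z | z ≟ x
      ... | inj₁ z∈A | _ = inj₁ z∈A
      ... | inj₂ _ | yes refl = inj₁ x∈A
      ... | inj₂ z∈B | no z≢x = inj₂ (x∈p∧x≢y⇒x∈p-y z∈B z≢x)
      nocross′ : ∀ {u v} → R u v → u ∉ B - x → v ∉ A → ⊥
      nocross′ {u} {v} r u∉ v∉ with u ∈? B | u ≟ x
      ... | no u∉B | _ = nocross r u∉B v∉
      ... | yes u∈B | no u≢x = u∉ (x∈p∧x≢y⇒x∈p-y u∈B u≢x)
      ... | yes _ | yes refl = none (v , v∉ , R-sym r)
    smaller : ∣ A ∩ (B - x) ∣ < ∣ A ∩ B ∣
    smaller = p⊂q⇒∣p∣<∣q∣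
      ( (λ z∈ → let z∈A , z∈B-x = x∈p∩q⁻ A _ z∈ in x∈p∩q⁺ (z∈A , proj₁ (x∈p-y⇒ z∈B-x)))
      , x , root∈A∩B p , λ x∈ → proj₂ (x∈p-y⇒ (proj₂ (x∈p∩q⁻ A _ x∈))) refl )
    bigB-x : Big Z N (B - x)
    bigB-x with linked A (B - x) sep′ (≤-trans (<⇒≤ smaller) (≤-trans order i≤N))
    ... | inj₂ b = b
    ... | inj₁ bigA = ⊥-elim (¬bigA (≤-trans order i≤N) big bigA)

  extend : ∀ {i} {F : Forest i} {A B q v} (st : State F A B) → v ∉ A → Attached q (State.root st) v →
    State (add F q) (A ∪ ⁅ v ⁆) B
  extend {i} {F} {A} {B} {q} {v} st v∉A att = record
    { sep = record
        { cover = λ z → [ inj₁ ∘ p⊆p∪q ⁅ v ⁆ , inj₂ ]′ (cover z)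
        ; nocross = λ r u∉ w∉ → nocross r u∉ (w∉ ∘ p⊆p∪q ⁅ v ⁆) }
    ; order = subst (∣ (A ∪ ⁅ v ⁆) ∩ B ∣ ≤_) (+-comm i 1) (≤-trans (∣p∣≤∣q∣+∣r∣ split)
        (+-mono-≤ order (≤-reflexive (∣⁅x⁆∣≡1 v))))
    ; big = big
    ; branch = branch′ ; root = root′ ; root∈ = root∈′ ; root∈A∩B = root∈A∩B′ ; branch⊆A = branch⊆A′
    ; conn = conn′ ; disjoint = λ {j} {k} → disjoint′ j k ; edge = edge′ }
    where
    open State st
    open Separation sep
    split : ∀ {x} → x ∈ (A ∪ ⁅ v ⁆) ∩ B → x ∈ A ∩ B ⊎ x ∈ ⁅ v ⁆
    split x∈ = let x∈A′ , x∈B = x∈p∩q⁻ (A ∪ ⁅ v ⁆) B x∈ in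
      [ (λ x∈A → inj₁ (x∈p∩q⁺ (x∈A , x∈B))) , inj₂ ]′ (x∈p∪q⁻ A ⁅ v ⁆ x∈A′)
    branch′ : Fin (suc i) → Subset n
    branch′ fzero = ⁅ v ⁆
    branch′ (fsuc j) = branch j
    root′ : Fin (suc i) → Fin n
    root′ fzero = v
    root′ (fsuc j) = root j
    root∈′ : ∀ j → root′ j ∈ branch′ j
    root∈′ fzero = x∈⁅x⁆ v
    root∈′ (fsuc j) = root∈ j
    root∈A∩B′ : ∀ j → root′ j ∈ (A ∪ ⁅ v ⁆) ∩ B
    root∈A∩B′ fzero = x∈p∩q⁺ (q⊆p∪q A _ (x∈⁅x⁆ v) , ∉P⇒∈Q v∉A)
    root∈A∩B′ (fsuc j) = let x∈A , x∈B = x∈p∩q⁻ A B (root∈A∩B j) in x∈p∩q⁺ (p⊆p∪q _ x∈A , x∈B)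
    branch⊆A′ : ∀ j → branch′ j ⊆ A ∪ ⁅ v ⁆
    branch⊆A′ fzero = q⊆p∪q A ⁅ v ⁆
    branch⊆A′ (fsuc j) = p⊆p∪q ⁅ v ⁆ ∘ branch⊆A j
    conn′ : ∀ j → Conn R (_∈ branch′ j)
    conn′ fzero = conn-⁅⁆
    conn′ (fsuc j) = conn j
    disjoint′ : ∀ j k {x} → x ∈ branch′ j → x ∈ branch′ k → j ≡ k
    disjoint′ fzero fzero _ _ = refl
    disjoint′ (fsuc j) (fsuc k) a b = cong fsuc (disjoint a b)
    disjoint′ fzero (fsuc k) a b = ⊥-elim (v∉A (subst (_∈ A) (x∈⁅y⁆⇒x≡y v a) (branch⊆A k b)))
    disjoint′ (fsuc k) fzero b a = ⊥-elim (v∉A (subst (_∈ A) (x∈⁅y⁆⇒x≡y v a) (branch⊆A k b)))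
    edge′ : ∀ {j k} → FEdge (add F q) j k → Touch R (_∈ branch′ j) (_∈ branch′ k)
    edge′ (new {p = p}) = v , root p , x∈⁅x⁆ v , root∈ p , att
    edge′ (old e) = edge e

  -- If the enlarged state is not tight, an improvement of order at most i lets the old roots move
  -- beyond the new vertex, after which we try again with a strictly larger A.
  grow : ∀ {i} {F : Forest i} {A B} → Acc _<_ ∣ ∁ A ∣ → State F A B → Tight i A B → i ≤ N → (q : Maybe (Fin i)) →
    ∃[ A′ ] ∃[ B′ ] (State (add F q) A′ B′ × Tight (suc i) A′ B′)
  grow {i} {F} {A} {B} (acc smaller) st tight i≤N q with new-vertex st tight i≤N q
  ... | v , v∉A , att with improvement? (suc i) (A ∪ ⁅ v ⁆) B
  ... | no ¬imp = A ∪ ⁅ v ⁆ , B , extend {q = q} st v∉A att , λ A′ B′ imp → ¬imp (A′ , B′ , imp)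
  ... | yes (A′ , B′ , sep′ , A∪v⊆A′ , B′⊆B , order′ , big′) =
    grow (smaller (p⊂q⇒∣p∣<∣q∣ (p⊂q⇒∁p⊃∁q (A⊆A′ , v , A∪v⊆A′ (q⊆p∪q A _ (x∈⁅x⁆ v)) , v∉A))))
      (reroot st tight (sep′ , A⊆A′ , B′⊆B , order′ , big′))
      (λ A″ B″ (sep″ , A′⊆A″ , B″⊆B′ , imp) →
        tight A″ B″ (sep″ , ⊆-trans A⊆A′ A′⊆A″ , ⊆-trans B″⊆B′ B′⊆B , imp))
      i≤N q
    where
    A⊆A′ : A ⊆ A′
    A⊆A′ = A∪v⊆A′ ∘ p⊆p∪q ⁅ v ⁆

  rooted-forest : ∀ {i} (F : Forest i) → i ≤ N → ∃[ A ] ∃[ B ] (State F A B × Tight i A B)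
  -- The separation of nothing from everything is tight because no order is below zero.
  rooted-forest nil _ = _ , _ , start , λ { _ _ (_ , _ , _ , () , _) }
    where
    sep₀ : Separation R (⊥ˢ {n}) ⊤ˢ
    sep₀ = record { cover = λ _ → inj₂ ∈⊤ ; nocross = λ _ u∉ _ → u∉ ∈⊤ }
    order₀ : ∣ ⊥ˢ {n} ∩ ⊤ˢ ∣ ≤ 0
    order₀ = ≤-trans (∣p∩q∣≤∣p∣ (⊥ˢ {n}) ⊤ˢ) (≤-reflexive (∣⊥∣≡0 n))
    ¬big⊥ : ¬ Big Z N ⊥ˢ
    ¬big⊥ lt = <⇒≱ lt (≤-trans (+-monoˡ-≤ N (≤-trans (∣p∩q∣≤∣q∣ Z ⊥ˢ) (≤-reflexive (∣⊥∣≡0 n))))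
      (≤-trans (m≤m+n N _) Z-large))
    start : State nil ⊥ˢ ⊤ˢ
    start = record
      { sep = sep₀ ; order = order₀
      ; big = [ ⊥-elim ∘ ¬big⊥ , id ]′ (linked _ _ sep₀ (≤-trans order₀ z≤n))
      ; branch = λ () ; root = λ () ; root∈ = λ () ; root∈A∩B = λ () ; branch⊆A = λ () ; conn = λ ()
      ; disjoint = λ { {()} } ; edge = λ () }
  rooted-forest (add F q) i<N = let _ , _ , st , tight = rooted-forest F (<⇒≤ i<N) in
    grow (<-wellFounded _) st tight (<⇒≤ i<N) q

-- Twisted ladders

record Model {n : ℕ} {I : Set} (R : Fin n → Fin n → Set) (E : I → I → Set) : Set where
  field
    part     : I → Subset n
    nonempty : ∀ i → ∃[ x ] x ∈ part i
    conn     : ∀ i → Conn R (_∈ part i)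
    disjoint : ∀ i j {x} → x ∈ part i → x ∈ part j → i ≡ j
    touch    : ∀ {i j} → E i j → Touch R (_∈ part i) (_∈ part j)

data Pos (s : ℕ) : Set where
  left rung right : Fin s → Pos s

-- `Ladder id` is the ordinary ladder with subdivided rungs; `π` records where the rungs arrive on
-- the right rail. Edges are listed in one direction and symmetrised where needed.
data Ladder {s : ℕ} (π : Fin s → Fin s) : Pos s → Pos s → Set where
  left-rail  : ∀ {a b} → toℕ b ≡ suc (toℕ a) → Ladder π (left a) (left b)
  right-rail : ∀ {a b} → toℕ b ≡ suc (toℕ a) → Ladder π (right a) (right b)
  to-left    : ∀ {t} → Ladder π (rung t) (left t)
  to-right   : ∀ {t} → Ladder π (rung t) (right (π t))

tip : ∀ t → Maybe (Fin (t * 2))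
tip zero = nothing
tip (suc t) = just (fsuc fzero)

-- Each spine vertex is followed by its tooth, so in the newest pair the tooth has index 0 and the
-- spine vertex index 1. Hence the value of `tip` and the second coordinates in `tooth` and `spine`.
comb : ∀ t → Forest (t * 2)
comb zero = nil
comb (suc t) = add (add (comb t) (tip t)) (just fzero)

tooth spine : ∀ {t} → Fin t → Fin (t * 2)
tooth a = combine a fzero
spine a = combine a (fsuc fzero)

spine-edge : ∀ {t} {a b : Fin t} → toℕ b ≡ suc (toℕ a) → FEdge (comb t) (spine a) (spine b)
spine-edge {suc (suc t)} {fzero} {fsuc fzero} _ = old new
spine-edge {suc t} {fsuc a} {fsuc b} eq = old (old (spine-edge (cong pred eq)))

tooth-edge : ∀ {t} (a : Fin t) → FEdge (comb t) (tooth a) (spine a)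
tooth-edge {suc t} fzero = new
tooth-edge {suc t} (fsuc a) = old (old (tooth-edge a))

tooth≢spine : ∀ {t} (a b : Fin t) → tooth a ≢ spine b
tooth≢spine a b eq with combine-injectiveʳ a fzero b (fsuc fzero) eq
... | ()

↑ˡ≢↑ʳ : ∀ {m k} (a : Fin m) (b : Fin k) → a ↑ˡ k ≢ m ↑ʳ b
↑ˡ≢↑ʳ {m} {k} a b eq with trans (sym (splitAt-↑ˡ m a k)) (trans (cong (splitAt m) eq) (splitAt-↑ʳ m k b))
... | ()

split-Fin : ∀ m {k} (i : Fin (m + k)) → (∃[ a ] a ↑ˡ k ≡ i) ⊎ (∃[ b ] m ↑ʳ b ≡ i)
split-Fin m i with splitAt m i in eq
... | inj₁ a = inj₁ (a , splitAt⁻¹-↑ˡ eq)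
... | inj₂ b = inj₂ (b , splitAt⁻¹-↑ʳ eq)

image : ∀ {n k} → (Fin k → Fin n) → Subset n
image f = comprehension λ x → any? λ i → f i ≟ x

∈-image⁺ : ∀ {n k} (f : Fin k → Fin n) i → f i ∈ image f
∈-image⁺ f i = ∈-comprehension⁺ (λ x → any? λ i → f i ≟ x) (i , refl)

∈-image⁻ : ∀ {n k} (f : Fin k → Fin n) {x} → x ∈ image f → ∃[ i ] f i ≡ x
∈-image⁻ f = ∈-comprehension⁻ λ x → any? λ i → f i ≟ x

∣image∣ : ∀ {n k} {f : Fin k → Fin n} → Injective _≡_ _≡_ f → ∣ image f ∣ ≡ k
∣image∣ {f = f} inj = Enumerates⇒∣p∣≡ (inj , ∈-image⁺ f , ∈-image⁻ f)

-- Linking the two halves of a comb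

module Rungs {n : ℕ} {R : Fin n → Fin n → Set} (R? : ∀ u v → Dec (R u v)) (R-sym : ∀ {u v} → R u v → R v u)
  {Z : Subset n} {N : ℕ} (Z-large : 5 * N ≤ ∣ Z ∣) (linked : WellLinked R Z N)
  {h : ℕ} (h≤N : (h + h) * 2 ≤ N) where

  open Grow R? R-sym {Z} {N} Z-large linked

  4h : h + (h + (h + h)) ≡ (h + h) * 2
  4h = solve 1 (λ h → h :+ (h :+ (h :+ h)) := (h :+ h) :* con 2) refl h

  toothˡ toothʳ : Fin h → Fin ((h + h) * 2)
  toothˡ t = tooth (t ↑ˡ h)
  toothʳ t = tooth (h ↑ʳ t)

  toothˡ-injective : ∀ {a b} → toothˡ a ≡ toothˡ b → a ≡ b
  toothˡ-injective {a} {b} eq = ↑ˡ-injective h a b (combine-injectiveˡ (a ↑ˡ h) fzero (b ↑ˡ h) fzero eq)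

  toothʳ-injective : ∀ {a b} → toothʳ a ≡ toothʳ b → a ≡ b
  toothʳ-injective {a} {b} eq = ↑ʳ-injective h a b (combine-injectiveˡ (h ↑ʳ a) fzero (h ↑ʳ b) fzero eq)

  spine-injective : ∀ a b → spine {h + h} a ≡ spine b → a ≡ b
  spine-injective a b = combine-injectiveˡ a (fsuc fzero) b (fsuc fzero)

  toothˡ≢toothʳ : ∀ a b → toothˡ a ≢ toothʳ b
  toothˡ≢toothʳ a b eq = ↑ˡ≢↑ʳ a b (combine-injectiveˡ (a ↑ˡ h) fzero (h ↑ʳ b) fzero eq)

  module FromComb {A B : Subset n} (st : State (comb (h + h)) A B) (tight : Tight ((h + h) * 2) A B) where
    open State st

    -- The spine roots, the tooth roots over either half of the spine, and the region left to the
    -- linking paths, which must avoid the spine.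
    W Y₁ Y₂ D : Subset n
    W = image (root ∘ spine {h + h})
    Y₁ = image (root ∘ toothˡ)
    Y₂ = image (root ∘ toothʳ)
    D = B ∩ ∁ W

    ∣W∣≡ : ∣ W ∣ ≡ h + h
    ∣W∣≡ = ∣image∣ λ {a} {b} eq → spine-injective a b (root-injective eq)

    ∣Y₁∣≡ : ∣ Y₁ ∣ ≡ h
    ∣Y₁∣≡ = ∣image∣ (toothˡ-injective ∘ root-injective)

    ∣Y₂∣≡ : ∣ Y₂ ∣ ≡ h
    ∣Y₂∣≡ = ∣image∣ (toothʳ-injective ∘ root-injective)

    W⊆A : W ⊆ A
    W⊆A x∈ with ∈-image⁻ (root ∘ spine {h + h}) x∈
    ... | a , refl = proj₁ (x∈p∩q⁻ A B (root∈A∩B (spine a)))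

    which : ∀ {x} → x ∈ A → x ∈ B → x ∉ W → x ∈ Y₁ ⊎ x ∈ Y₂
    which x∈A x∈B x∉W with proj₂ (proj₂ roots) (x∈p∩q⁺ (x∈A , x∈B))
    ... | j , refl with combine-surjective {h + h} {2} j
    ... | a , fsuc fzero , refl = ⊥-elim (x∉W (∈-image⁺ (root ∘ spine {h + h}) a))
    ... | a , fzero , refl with split-Fin h a
    ... | inj₁ (t , refl) = inj₁ (∈-image⁺ (root ∘ toothˡ) t)
    ... | inj₂ (t , refl) = inj₂ (∈-image⁺ (root ∘ toothʳ) t)

    R₂ : Fin n → Fin n → Set
    R₂ u v = R u v × u ∈ D × v ∈ D

    R₂? : ∀ u v → Dec (R₂ u v)
    R₂? u v = R? u v ×-dec (u ∈? D) ×-dec (v ∈? D)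

    R₂-sym : ∀ {u v} → R₂ u v → R₂ v u
    R₂-sym (r , u∈ , v∈) = R-sym r , v∈ , u∈

    -- `(A ∪ P , B ∩ (Q ∪ W))` lies beyond `(A , B)`, and its overlap lies in the union of `P ∩ Q`,
    -- `Y′` and `W`: fewer than `h + h + 2 h` vertices, which is the order of the comb. A big far
    -- side would contradict tightness, so the near side is big.
    half : ∀ {Y Y′ P Q} → Separation R₂ P Q → ∣ P ∩ Q ∣ < h → Y ⊆ P → ∣ Y′ ∣ ≡ h →
      (∀ {x} → x ∈ A → x ∈ B → x ∉ W → x ∈ Y ⊎ x ∈ Y′) → Big Z N (A ∪ P)
    half {Y} {Y′} {P} {Q} sep₂ order₂ Y⊆P ∣Y′∣≡h which =
      [ id , (λ bigB₁ → ⊥-elim (tight _ _ (sep₁ , p⊆p∪q P , p∩q⊆p B _ , order₁ , bigB₁))) ]′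
        (linked A₁ B₁ sep₁ (≤-trans (<⇒≤ order₁) h≤N))
      where
      open Separation sep
      module S₂ = Separation sep₂
      A₁ = A ∪ P
      B₁ = B ∩ (Q ∪ W)
      sep₁ : Separation R A₁ B₁
      sep₁ = record { cover = cover₁ ; nocross = nocross₁ }
        where
        cover₁ : ∀ x → x ∈ A₁ ⊎ x ∈ B₁
        cover₁ x with cover x | S₂.cover x
        ... | inj₁ x∈A | _ = inj₁ (p⊆p∪q P x∈A)
        ... | inj₂ _ | inj₁ x∈P = inj₁ (q⊆p∪q A P x∈P)
        ... | inj₂ x∈B | inj₂ x∈Q = inj₂ (x∈p∩q⁺ (x∈B , p⊆p∪q W x∈Q))
        nocross₁ : ∀ {u v} → R u v → u ∉ B₁ → v ∉ A₁ → ⊥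
        nocross₁ {u} {v} r u∉ v∉ with u ∈? B
        ... | no u∉B = nocross r u∉B (v∉ ∘ p⊆p∪q P)
        ... | yes u∈B = S₂.nocross
          (r , x∈p∩q⁺ (u∈B , x∉p⇒x∈∁p λ u∈W → u∉ (x∈p∩q⁺ (u∈B , q⊆p∪q Q W u∈W)))
             , x∈p∩q⁺ (∉P⇒∈Q (v∉ ∘ p⊆p∪q P) , x∉p⇒x∈∁p (v∉ ∘ p⊆p∪q P ∘ W⊆A)))
          (λ u∈Q → u∉ (x∈p∩q⁺ (u∈B , p⊆p∪q W u∈Q))) (v∉ ∘ q⊆p∪q A P)
      meet : ∀ {x} → x ∈ A₁ ∩ B₁ → x ∈ P ∩ Q ⊎ x ∈ Y′ ∪ W
      meet {x} x∈ with x∈p∩q⁻ A₁ B₁ x∈ | x ∈? W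
      ... | _ | yes x∈W = inj₂ (q⊆p∪q Y′ W x∈W)
      ... | x∈A₁ , x∈B₁ | no x∉W with x∈p∩q⁻ B _ x∈B₁ | x∈p∪q⁻ A P x∈A₁
      ... | x∈B , x∈QW | inj₂ x∈P = inj₁ (x∈p∩q⁺ (x∈P , [ id , ⊥-elim ∘ x∉W ]′ (x∈p∪q⁻ Q W x∈QW)))
      ... | x∈B , x∈QW | inj₁ x∈A with which x∈A x∈B x∉W
      ... | inj₁ x∈Y = inj₁ (x∈p∩q⁺ (Y⊆P x∈Y , [ id , ⊥-elim ∘ x∉W ]′ (x∈p∪q⁻ Q W x∈QW)))
      ... | inj₂ x∈Y′ = inj₂ (p⊆p∪q W x∈Y′)
      order₁ : ∣ A₁ ∩ B₁ ∣ < (h + h) * 2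
      order₁ = <-≤-trans (≤-<-trans (∣p∣≤∣q∣+∣r∣ meet) (+-monoˡ-< ∣ Y′ ∪ W ∣ order₂))
        (subst (h + ∣ Y′ ∪ W ∣ ≤_) 4h (+-monoʳ-≤ h (≤-trans (∣p∣≤∣q∣+∣r∣ (x∈p∪q⁻ Y′ W))
          (≤-reflexive (cong₂ _+_ ∣Y′∣≡h ∣W∣≡)))))

    h≤N′ : h ≤ N
    h≤N′ = ≤-trans (≤-trans (m≤m+n h _) (≤-reflexive 4h)) h≤N

    -- `A ∪ P`, `A ∪ Q` and `B` would all be big, yet their common part lies in `A ∩ B` together
    -- with `P ∩ Q`, at most `2 N` vertices.
    no-separator : ¬ Separator R₂ Y₁ Y₂ h
    no-separator (separator P Q sep₂ Y₁⊆P Y₂⊆Q order₂) =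
      ¬big³ (half sep₂ order₂ Y₁⊆P ∣Y₂∣≡ which)
            (half (Separation-sym R₂-sym sep₂) (subst (λ S → ∣ S ∣ < h) (∩-comm P Q) order₂) Y₂⊆Q ∣Y₁∣≡
              (λ a b w → [ inj₂ , inj₁ ]′ (which a b w)))
            big
            (≤-trans (∣p∣≤∣q∣+∣r∣ meet)
              (+-mono-≤ (≤-trans order h≤N) (≤-trans (<⇒≤ order₂) (≤-trans h≤N′ (m≤m+n N 0)))))
      where
      meet : ∀ {x} → x ∈ ((A ∪ P) ∩ (A ∪ Q)) ∩ B → x ∈ A ∩ B ⊎ x ∈ P ∩ Q
      meet x∈ with x∈p∩q⁻ _ B x∈
      ... | x∈AA , x∈B with x∈p∩q⁻ (A ∪ P) _ x∈AA
      ... | x∈AP , x∈AQ with x∈p∪q⁻ A P x∈AP | x∈p∪q⁻ A Q x∈AQ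
      ... | inj₁ x∈A | _ = inj₁ (x∈p∩q⁺ (x∈A , x∈B))
      ... | inj₂ _ | inj₁ x∈A = inj₁ (x∈p∩q⁺ (x∈A , x∈B))
      ... | inj₂ x∈P | inj₂ x∈Q = inj₂ (x∈p∩q⁺ (x∈P , x∈Q))

    module FromLinkage (L : Linkage R₂ Y₁ Y₂ h) where
      module ℓ = Linkage L
      open ℓ using (path; source; target)

      matched : ∀ t → ∃[ l ] proj₁ (source l) ≡ root (toothˡ t)
      matched t = proj₂ (proj₂ (ℓ.sources (≤-reflexive ∣Y₁∣≡))) (∈-image⁺ (root ∘ toothˡ) t)

      ι : Fin h → Fin h
      ι = proj₁ ∘ matched

      ι∈ : ∀ t → root (toothˡ t) ∈ path (ι t)
      ι∈ t = subst (_∈ path (ι t)) (proj₂ (matched t)) (proj₁ (proj₂ (source (ι t))))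

      ι-injective : ∀ {t u} → ι t ≡ ι u → t ≡ u
      ι-injective {t} {u} eq = toothˡ-injective (root-injective
        (trans (sym (proj₂ (matched t))) (trans (cong (proj₁ ∘ source) eq) (proj₂ (matched u)))))

      hit : ∀ t → ∃[ u ] root (toothʳ u) ≡ proj₁ (target (ι t))
      hit t = ∈-image⁻ (root ∘ toothʳ) (proj₂ (proj₂ (target (ι t))))

      π : Fin h → Fin h
      π = proj₁ ∘ hit

      π∈ : ∀ t → root (toothʳ (π t)) ∈ path (ι t)
      π∈ t = subst (_∈ path (ι t)) (sym (proj₂ (hit t))) (proj₁ (proj₂ (target (ι t))))

      π-injective : Injective _≡_ _≡_ π
      π-injective {t} {u} eq = ι-injective (ℓ.target-injective
        (trans (sym (proj₂ (hit t))) (trans (cong (root ∘ toothʳ) eq) (proj₂ (hit u)))))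

      path⊆D : ∀ {l x} → x ∈ path l → x ∈ D
      path⊆D {l} {x} x∈ = let a , a∈ , a∈Y₁ = source l in
        walk-invariant (λ r _ → proj₂ (proj₂ r)) (ℓ.conn l a x a∈ x∈) (Y₁⊆D a∈Y₁)
        where
        Y₁⊆D : Y₁ ⊆ D
        Y₁⊆D x∈ with ∈-image⁻ (root ∘ toothˡ) x∈
        ... | t , refl = x∈p∩q⁺ (proj₂ (x∈p∩q⁻ A B (root∈A∩B _)) , x∉p⇒x∈∁p λ x∈W →
          let b , eq = ∈-image⁻ (root ∘ spine {h + h}) x∈W in tooth≢spine (t ↑ˡ h) b (root-injective (sym eq)))

      Teeth : Fin h → Fin ((h + h) * 2) → Set
      Teeth t j = j ≡ toothˡ t ⊎ j ≡ toothʳ (π t)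

      teeth-disjoint : ∀ {t u j} → Teeth t j → Teeth u j → t ≡ u
      teeth-disjoint (inj₁ refl) (inj₁ eq) = toothˡ-injective eq
      teeth-disjoint {t} {u} (inj₁ refl) (inj₂ eq) = ⊥-elim (toothˡ≢toothʳ t (π u) eq)
      teeth-disjoint {t} {u} (inj₂ refl) (inj₁ eq) = ⊥-elim (toothˡ≢toothʳ u (π t) (sym eq))
      teeth-disjoint (inj₂ refl) (inj₂ eq) = π-injective (toothʳ-injective eq)

      -- In `D` a branch set has at most its root, and spine roots are excluded. The linkage uses up
      -- all of `Y₁` and `Y₂`, so a tooth root on a path is an end of that path.
      meet : ∀ {t j x} → x ∈ branch j → x ∈ path (ι t) → Teeth t j
      meet {t} {j} {x} x∈j x∈t = go (which (branch⊆A j x∈j) x∈B (x∈∁p⇒x∉p x∈∁W))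
        where
        x∈B = proj₁ (x∈p∩q⁻ B _ (path⊆D x∈t))
        x∈∁W = proj₂ (x∈p∩q⁻ B _ (path⊆D x∈t))
        x≡root : x ≡ root j
        x≡root = at-root x∈j x∈B
        go : x ∈ Y₁ ⊎ x ∈ Y₂ → Teeth t j
        go (inj₁ x∈Y₁) = inj₁ (root-injective (trans (sym x≡root)
          (trans (ℓ.at-source (≤-reflexive ∣Y₁∣≡) x∈t x∈Y₁) (proj₂ (matched t)))))
        go (inj₂ x∈Y₂) = inj₂ (root-injective (trans (sym x≡root)
          (trans (ℓ.at-target (≤-reflexive ∣Y₂∣≡) x∈t x∈Y₂) (sym (proj₂ (hit t))))))

      -- The edges to the two rails come from the teeth, which are therefore absorbed into the path.
      rung-set : Fin h → Subset n
      rung-set t = branch (toothˡ t) ∪ (path (ι t) ∪ branch (toothʳ (π t)))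

      InRung : Fin h → Fin n → Set
      InRung t x = (∃[ j ] (Teeth t j × x ∈ branch j)) ⊎ x ∈ path (ι t)

      ∈-rung⁻ : ∀ {t x} → x ∈ rung-set t → InRung t x
      ∈-rung⁻ {t} x∈ =
        [ (λ x∈l → inj₁ (toothˡ t , inj₁ refl , x∈l))
        , (λ x∈′ → [ inj₂ , (λ x∈r → inj₁ (toothʳ (π t) , inj₂ refl , x∈r)) ]′
            (x∈p∪q⁻ (path (ι t)) (branch (toothʳ (π t))) x∈′)) ]′
        (x∈p∪q⁻ (branch (toothˡ t)) (path (ι t) ∪ branch (toothʳ (π t))) x∈)

      rungs-disjoint : ∀ {t u x} → InRung t x → InRung u x → t ≡ u
      rungs-disjoint {u = u} (inj₁ (j , tj , x∈j)) (inj₁ (k , uk , x∈k)) =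
        teeth-disjoint tj (subst (Teeth u) (disjoint x∈k x∈j) uk)
      rungs-disjoint (inj₁ (j , tj , x∈j)) (inj₂ x∈u) = teeth-disjoint tj (meet x∈j x∈u)
      rungs-disjoint (inj₂ x∈t) (inj₁ (j , uj , x∈j)) = teeth-disjoint (meet x∈j x∈t) uj
      rungs-disjoint (inj₂ x∈t) (inj₂ x∈u) = ι-injective (ℓ.disjoint x∈t x∈u)

      teeth≢spine : ∀ t a → ¬ Teeth t (spine a)
      teeth≢spine t a (inj₁ eq) = tooth≢spine (t ↑ˡ h) a (sym eq)
      teeth≢spine t a (inj₂ eq) = tooth≢spine (h ↑ʳ π t) a (sym eq)

      rung-spine-disjoint : ∀ t a {x} → x ∈ rung-set t → x ∈ branch (spine a) → ⊥
      rung-spine-disjoint t a x∈t x∈a =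
        [ (λ (j , tj , x∈j) → teeth≢spine t a (subst (Teeth t) (disjoint x∈j x∈a) tj))
        , (λ x∈p → teeth≢spine t a (meet x∈a x∈p)) ]′ (∈-rung⁻ {t} x∈t)

      part : Pos h → Subset n
      part (left a) = branch (spine (a ↑ˡ h))
      part (right a) = branch (spine (h ↑ʳ a))
      part (rung t) = rung-set t

      model : Model R (Ladder π)
      model = record
        { part = part ; nonempty = nonempty ; conn = conn′ ; disjoint = disjoint′ ; touch = touch′ }
        where
        nonempty : ∀ p → ∃[ x ] x ∈ part p
        nonempty (left a) = _ , root∈ _
        nonempty (right a) = _ , root∈ _
        nonempty (rung t) = _ , p⊆p∪q _ (root∈ _)
        conn′ : ∀ p → Conn R (_∈ part p)
        conn′ (left a) = conn _
        conn′ (right a) = conn _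
        conn′ (rung t) = conn-∪ R-sym (conn _)
          (conn-∪ R-sym (λ u v u∈ v∈ → walk-map proj₁ id (ℓ.conn (ι t) u v u∈ v∈)) (conn _)
            (π∈ t) (root∈ _) (inj₁ refl))
          (root∈ _) (p⊆p∪q _ (ι∈ t)) (inj₁ refl)
        disjoint′ : ∀ p q {x} → x ∈ part p → x ∈ part q → p ≡ q
        disjoint′ (left a) (left b) x∈ x∈′ =
          cong left (↑ˡ-injective h a b (spine-injective (a ↑ˡ h) (b ↑ˡ h) (disjoint x∈ x∈′)))
        disjoint′ (right a) (right b) x∈ x∈′ =
          cong right (↑ʳ-injective h a b (spine-injective (h ↑ʳ a) (h ↑ʳ b) (disjoint x∈ x∈′)))
        disjoint′ (rung t) (rung u) x∈ x∈′ =
          cong rung (rungs-disjoint {t} {u} (∈-rung⁻ {t} x∈) (∈-rung⁻ {u} x∈′))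
        disjoint′ (left a) (right b) x∈ x∈′ =
          ⊥-elim (↑ˡ≢↑ʳ a b (spine-injective (a ↑ˡ h) (h ↑ʳ b) (disjoint x∈ x∈′)))
        disjoint′ (right b) (left a) x∈′ x∈ =
          ⊥-elim (↑ˡ≢↑ʳ a b (spine-injective (a ↑ˡ h) (h ↑ʳ b) (disjoint x∈ x∈′)))
        disjoint′ (left a) (rung t) x∈ x∈′ = ⊥-elim (rung-spine-disjoint t (a ↑ˡ h) x∈′ x∈)
        disjoint′ (right a) (rung t) x∈ x∈′ = ⊥-elim (rung-spine-disjoint t (h ↑ʳ a) x∈′ x∈)
        disjoint′ (rung t) (left a) x∈′ x∈ = ⊥-elim (rung-spine-disjoint t (a ↑ˡ h) x∈′ x∈)
        disjoint′ (rung t) (right a) x∈′ x∈ = ⊥-elim (rung-spine-disjoint t (h ↑ʳ a) x∈′ x∈)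
        touch′ : ∀ {p q} → Ladder π p q → Touch R (_∈ part p) (_∈ part q)
        touch′ (left-rail {a} {b} eq) = edge (spine-edge
          (trans (toℕ-↑ˡ b h) (trans eq (cong suc (sym (toℕ-↑ˡ a h))))))
        touch′ (right-rail {a} {b} eq) = edge (spine-edge
          (trans (toℕ-↑ʳ h b) (trans (cong (h +_) eq) (trans (+-suc h _) (cong suc (sym (toℕ-↑ʳ h a)))))))
        touch′ (to-left {t}) = let x , y , x∈ , y∈ , r = edge (tooth-edge (t ↑ˡ h)) in
          x , y , p⊆p∪q _ x∈ , y∈ , r
        touch′ (to-right {t}) = let x , y , x∈ , y∈ , r = edge (tooth-edge (h ↑ʳ π t)) in
          x , y , q⊆p∪q (branch (toothˡ t)) _ (q⊆p∪q (path (ι t)) _ x∈) , y∈ , r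

    twisted-ladder′ : ∃[ π ] (Injective _≡_ _≡_ π × Model R (Ladder {h} π))
    twisted-ladder′ with menger R₂? R₂-sym Y₁ Y₂ h
    ... | inj₂ S = ⊥-elim (no-separator S)
    ... | inj₁ L = π , π-injective , model
      where open FromLinkage L

  twisted-ladder : ∃[ π ] (Injective _≡_ _≡_ π × Model R (Ladder {h} π))
  twisted-ladder = let _ , _ , st , tight = rooted-forest (comb (h + h)) h≤N in FromComb.twisted-ladder′ st tight

-- Straightening a ladder

Sym : {V : Set} → (V → V → Set) → V → V → Set
Sym E u v = E u v ⊎ E v u

Sym-sym : ∀ {V : Set} {E : V → V → Set} {u v} → Sym E u v → Sym E v u
Sym-sym = [ inj₂ , inj₁ ]′

walk-image : ∀ {V V′ : Set} {R : V → V → Set} {R′ : V′ → V′ → Set} {S : V → Set} {S′ : V′ → Set} (f : V → V′) →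
  (∀ {u v} → R u v → R′ (f u) (f v)) → (∀ {u} → S u → S′ (f u)) → ∀ {u v} → Walk R S u v → Walk R′ S′ (f u) (f v)
walk-image f r s (here su) = here (s su)
walk-image f r s (step su e p) = step (s su) (r e) (walk-image f r s p)

conn-centre : ∀ {V : Set} {E : V → V → Set} {S : V → Set} (c : V) →
  (∀ u → S u → Walk (Sym E) S u c) → Conn (Sym E) S
conn-centre {E = E} c to u v su sv = walk-trans (to u su) (walk-sym (Sym-sym {E = E}) (to v sv))

-- Needed to turn a union of parts over a decidable family of indices into a `Subset`.
Searchable : Set → Set₁
Searchable I = ∀ {P : I → Set} → (∀ i → Dec (P i)) → Dec (∃ P)

search-Pos : ∀ {s} → Searchable (Pos s)
search-Pos P? = map′
  [ (λ (a , p) → left a , p) , [ (λ (a , p) → rung a , p) , (λ (a , p) → right a , p) ]′ ]′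
  (λ { (left a , p) → inj₁ (a , p) ; (rung a , p) → inj₂ (inj₁ (a , p)) ; (right a , p) → inj₂ (inj₂ (a , p)) })
  (any? (P? ∘ left) ⊎-dec any? (P? ∘ rung) ⊎-dec any? (P? ∘ right))

-- The minor relation between abstract graphs; the fibres need not cover `I`. Arbitrary index types
-- spare a numbering of the ladder, and `contract` applies successive contractions to a concrete
-- model.
record Contraction {I J : Set} (E : I → I → Set) (E′ : J → J → Set) : Set₁ where
  field
    fibre    : J → I → Set
    fibre?   : ∀ j i → Dec (fibre j i)
    nonempty : ∀ j → ∃ (fibre j)
    conn     : ∀ j → Conn (Sym E) (fibre j)
    disjoint : ∀ j k {i} → fibre j i → fibre k i → j ≡ k
    touch    : ∀ {j k} → E′ j k → Touch (Sym E) (fibre j) (fibre k)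

contract : ∀ {n} {I J : Set} {R : Fin n → Fin n → Set} {E : I → I → Set} {E′ : J → J → Set} →
  (∀ {u v} → R u v → R v u) → Searchable I → Contraction E E′ → Model R E → Model R E′
contract {n} {I} {J} {R} {E} {E′} R-sym search C M = record
  { part = part ; nonempty = nonempty ; conn = conn ; disjoint = disjoint ; touch = touch }
  where
  module C = Contraction C
  module M = Model M
  member? : ∀ j x → Dec (∃[ i ] (C.fibre j i × x ∈ M.part i))
  member? j x = search λ i → C.fibre? j i ×-dec (x ∈? M.part i)
  part : J → Subset n
  part j = comprehension (member? j)
  ∈-part⁺ : ∀ j {i x} → C.fibre j i → x ∈ M.part i → x ∈ part j
  ∈-part⁺ j f x∈ = ∈-comprehension⁺ (member? j) (_ , f , x∈)
  ∈-part⁻ : ∀ j {x} → x ∈ part j → ∃[ i ] (C.fibre j i × x ∈ M.part i)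
  ∈-part⁻ j = ∈-comprehension⁻ (member? j)
  nonempty : ∀ j → ∃[ x ] x ∈ part j
  nonempty j = let i , f = C.nonempty j ; x , x∈ = M.nonempty i in x , ∈-part⁺ j f x∈
  sym-touch : ∀ {i i′} → Sym E i i′ → Touch R (_∈ M.part i) (_∈ M.part i′)
  sym-touch (inj₁ e) = M.touch e
  sym-touch (inj₂ e) = let x , y , x∈ , y∈ , r = M.touch e in y , x , y∈ , x∈ , R-sym r
  lift : ∀ j {i i′} → Walk (Sym E) (C.fibre j) i i′ → ∀ {x y} → x ∈ M.part i → y ∈ M.part i′ →
    Walk R (_∈ part j) x y
  lift j {i} (here f) x∈ y∈ = walk-map id (∈-part⁺ j f) (M.conn i _ _ x∈ y∈)
  lift j {i} (step f e p) x∈ y∈ = let u , v , u∈ , v∈ , r = sym-touch e in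
    walk-trans (walk-map id (∈-part⁺ j f) (M.conn i _ _ x∈ u∈)) (step (∈-part⁺ j f u∈) r (lift j p v∈ y∈))
  conn : ∀ j → Conn R (_∈ part j)
  conn j x y x∈ y∈ = let i , f , x∈i = ∈-part⁻ j x∈ ; i′ , f′ , y∈i′ = ∈-part⁻ j y∈ in
    lift j (C.conn j i i′ f f′) x∈i y∈i′
  disjoint : ∀ j k {x} → x ∈ part j → x ∈ part k → j ≡ k
  disjoint j k x∈j x∈k = let i , f , x∈i = ∈-part⁻ j x∈j ; i′ , f′ , x∈i′ = ∈-part⁻ k x∈k in
    C.disjoint j k f (subst (C.fibre k) (M.disjoint i′ i x∈i′ x∈i) f′)
  touch : ∀ {j k} → E′ j k → Touch R (_∈ part j) (_∈ part k)
  touch {j} {k} e = let i , i′ , f , f′ , s = C.touch e ; x , y , x∈ , y∈ , r = sym-touch s in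
    x , y , ∈-part⁺ j f x∈ , ∈-part⁺ k f′ y∈ , r

Next : ∀ {h} → Fin h → Fin h → Set
Next a b = toℕ b ≡ suc (toℕ a)

predecessor : ∀ {h} (x : Fin h) {m} → m < toℕ x → ∃[ t ] (Next t x × m ≤ toℕ t)
predecessor (fsuc t) {m} (s≤s m≤t) =
  inject₁ t , cong suc (sym (toℕ-inject₁ t)) , subst (m ≤_) (sym (toℕ-inject₁ t)) m≤t

Increasing : ∀ {s h} → (Fin s → Fin h) → Set
Increasing g = ∀ {a b} → toℕ a < toℕ b → toℕ (g a) < toℕ (g b)

increasing-≤ : ∀ {s h} {g : Fin s → Fin h} → Increasing g → ∀ {a b} → toℕ a ≤ toℕ b → toℕ (g a) ≤ toℕ (g b)
increasing-≤ {g = g} inc {a} {b} a≤b with m≤n⇒m<n∨m≡n a≤b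
... | inj₁ a<b = <⇒≤ (inc a<b)
... | inj₂ a≡b = ≤-reflexive (cong (toℕ ∘ g) (toℕ-injective a≡b))

-- The interval of a rail from `g j` up to the next chosen point. Quantifying over all later `j′`
-- lets the last interval run to the end of the rail.
Block : ∀ {s h} → (Fin s → Fin h) → Fin s → Fin h → Set
Block g j t = toℕ (g j) ≤ toℕ t × (∀ j′ → toℕ j < toℕ j′ → toℕ t < toℕ (g j′))

block? : ∀ {s h} (g : Fin s → Fin h) j t → Dec (Block g j t)
block? g j t = (toℕ (g j) ≤? toℕ t) ×-dec all? (λ j′ → (toℕ j <? toℕ j′) →-dec (toℕ t <? toℕ (g j′)))

module _ {s h : ℕ} {g : Fin s → Fin h} (inc : Increasing g) where

  block-start : ∀ j → Block g j (g j)
  block-start j = ≤-refl , λ _ → inc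

  block-disjoint : ∀ j k {t} → Block g j t → Block g k t → j ≡ k
  block-disjoint j k (j≤ , <j) (k≤ , <k) with <-cmp (toℕ j) (toℕ k)
  ... | tri< j<k _ _ = ⊥-elim (<⇒≱ (<j k j<k) k≤)
  ... | tri≈ _ j≡k _ = toℕ-injective j≡k
  ... | tri> _ _ k<j = ⊥-elim (<⇒≱ (<k j k<j) j≤)

  block-conn : ∀ j → Conn (Sym Next) (Block g j)
  block-conn j = conn-centre (g j) λ t → down (<-wellFounded (toℕ t)) t refl
    where
    down : ∀ {m} → Acc _<_ m → ∀ t → toℕ t ≡ m → Block g j t → Walk (Sym Next) (Block g j) t (g j)
    down (acc smaller) t refl b@(g≤t , <j) with m≤n⇒m<n∨m≡n g≤t
    ... | inj₂ eq = subst (Walk _ _ t) (toℕ-injective (sym eq)) (here b)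
    down (acc smaller) (fsuc t) refl b@(_ , <j) | inj₁ (s≤s g≤t) =
      step b (inj₂ (cong suc (sym (toℕ-inject₁ t))))
        (down (smaller (s≤s (≤-reflexive (toℕ-inject₁ t)))) (inject₁ t) refl
          (subst (toℕ (g j) ≤_) (sym (toℕ-inject₁ t)) g≤t
          , λ j′ lt → subst (_< toℕ (g j′)) (sym (toℕ-inject₁ t)) (<-trans (n<1+n _) (<j j′ lt))))

  -- The vertex just before `g b` still belongs to the interval of `a`, since no index lies between
  -- `a` and `b`.
  block-touch : ∀ {a b} → Next a b → Touch Next (Block g a) (Block g b)
  block-touch {a} {b} next = let t , t-gb , ga≤t = predecessor (g b) (inc {a} {b} (≤-reflexive (sym next))) in
    t , g b
    , (ga≤t , λ j′ a<j′ → ≤-trans (≤-reflexive (sym t-gb))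
        (increasing-≤ inc (subst (_≤ toℕ j′) (sym next) a<j′)))
    , block-start b , t-gb

  sym-block-touch : ∀ {a b} → Sym Next a b → Touch (Sym Next) (Block g a) (Block g b)
  sym-block-touch (inj₁ e) = let x , y , x∈ , y∈ , r = block-touch e in x , y , x∈ , y∈ , inj₁ r
  sym-block-touch (inj₂ e) = let x , y , x∈ , y∈ , r = block-touch e in y , x , y∈ , x∈ , inj₂ r

-- `g₂` lists the right ends `π (g a)` in their order along the rail, and `ρ a` is the place of the
-- `a`-th one. A step may go either way under `ρ`, which admits a right rail read backwards.
straighten : ∀ {s h} {π : Fin h → Fin h} {g g₂ : Fin s → Fin h} (ρ : Fin s → Fin s) →
  Increasing g → Increasing g₂ → Injective _≡_ _≡_ ρ → (∀ {a b} → Next a b → Sym Next (ρ a) (ρ b)) →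
  (∀ a → g₂ (ρ a) ≡ π (g a)) → Contraction (Ladder π) (Ladder {s} id)
straighten {s} {h} {π} {g} {g₂} ρ inc inc₂ ρ-inj ρ-next g₂ρ≡πg = record
  { fibre = fibre ; fibre? = fibre? ; nonempty = nonempty ; conn = conn ; disjoint = disjoint ; touch = touch }
  where
  fibre : Pos s → Pos h → Set
  fibre (left a) (left t) = Block g a t
  fibre (rung a) (rung t) = t ≡ g a
  fibre (right a) (right t) = Block g₂ (ρ a) t
  fibre _ _ = ⊥
  fibre? : ∀ p q → Dec (fibre p q)
  fibre? (left a) (left t) = block? g a t
  fibre? (left a) (rung t) = no id
  fibre? (left a) (right t) = no id
  fibre? (rung a) (left t) = no id
  fibre? (rung a) (rung t) = t ≟ g a
  fibre? (rung a) (right t) = no id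
  fibre? (right a) (left t) = no id
  fibre? (right a) (rung t) = no id
  fibre? (right a) (right t) = block? g₂ (ρ a) t
  nonempty : ∀ p → ∃ (fibre p)
  nonempty (left a) = left (g a) , block-start inc a
  nonempty (rung a) = rung (g a) , refl
  nonempty (right a) = right (g₂ (ρ a)) , block-start inc₂ (ρ a)
  sym-left : ∀ {a b} → Sym Next a b → Sym (Ladder π) (left a) (left b)
  sym-left = [ inj₁ ∘ left-rail , inj₂ ∘ left-rail ]′
  sym-right : ∀ {a b} → Sym Next a b → Sym (Ladder π) (right a) (right b)
  sym-right = [ inj₁ ∘ right-rail , inj₂ ∘ right-rail ]′
  conn : ∀ p → Conn (Sym (Ladder π)) (fibre p)
  conn (left a) (left t) (left u) ft fu = walk-image left sym-left id (block-conn inc a t u ft fu)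
  conn (rung a) (rung t) (rung u) refl refl = here refl
  conn (right a) (right t) (right u) ft fu = walk-image right sym-right id (block-conn inc₂ (ρ a) t u ft fu)
  g-inj : ∀ a b → g a ≡ g b → a ≡ b
  g-inj a b eq = block-disjoint inc a b (block-start inc a) (subst (Block g b) (sym eq) (block-start inc b))
  disjoint : ∀ p q {i} → fibre p i → fibre q i → p ≡ q
  disjoint (left a) (left b) {left t} fa fb = cong left (block-disjoint inc a b fa fb)
  disjoint (rung a) (rung b) {rung t} fa fb = cong rung (g-inj a b (trans (sym fa) fb))
  disjoint (right a) (right b) {right t} fa fb = cong right (ρ-inj (block-disjoint inc₂ (ρ a) (ρ b) fa fb))
  touch : ∀ {p q} → Ladder id p q → Touch (Sym (Ladder π)) (fibre p) (fibre q)
  touch (left-rail eq) = let t , u , ft , fu , e = sym-block-touch inc (inj₁ eq) in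
    left t , left u , ft , fu , sym-left e
  touch (right-rail eq) = let t , u , ft , fu , e = sym-block-touch inc₂ (ρ-next eq) in
    right t , right u , ft , fu , sym-right e
  touch (to-left {a}) = rung (g a) , left (g a) , refl , block-start inc a , inj₁ to-left
  touch (to-right {a}) = rung (g a) , right (π (g a)) , refl
    , subst (Block g₂ (ρ a)) (g₂ρ≡πg a) (block-start inc₂ (ρ a)) , inj₁ to-right

-- Monotone subsequences

module _ {h : ℕ} {Q : Fin h → Fin h → Set} (Q? : ∀ i j → Dec (Q i j)) where

  Chain : ℕ → Fin h → Set
  Chain zero i = Unit
  Chain (suc l) i = ∃[ j ] (Q i j × Chain l j)

  chain? : ∀ l i → Dec (Chain l i)
  chain? zero i = yes tt
  chain? (suc l) i = any? λ j → Q? i j ×-dec chain? l j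

  chain-length : ∀ s {i} → ¬ Chain s i → ∃[ u ] (Chain (toℕ {s} u) i × ¬ Chain (suc (toℕ u)) i)
  chain-length zero none = ⊥-elim (none tt)
  chain-length (suc s) {i} none with chain? s i
  ... | yes c = fromℕ s , subst (λ l → Chain l i) (sym (toℕ-fromℕ s)) c
                        , subst (λ l → ¬ Chain (suc l) i) (sym (toℕ-fromℕ s)) none
  ... | no none′ = let u , c , nc = chain-length s none′ in
    inject₁ u , subst (λ l → Chain l i) (sym (toℕ-inject₁ u)) c
              , subst (λ l → ¬ Chain (suc l) i) (sym (toℕ-inject₁ u)) nc

  -- The starting point is left out, so a chain of `s` steps yields `s` points.
  chain-sequence : (∀ {i j k} → Q i j → Q j k → Q i k) → ∀ s {i} → Chain s i →
    Σ (Fin s → Fin h) λ g → (∀ {a b} → toℕ a < toℕ b → Q (g a) (g b))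
  chain-sequence Q-trans s c = sequence c , related c
    where
    sequence : ∀ {s i} → Chain s i → Fin s → Fin h
    sequence {suc s} (j , _ , c) fzero = j
    sequence {suc s} (j , _ , c) (fsuc a) = sequence c a
    first : ∀ {s i} (c : Chain s i) a → Q i (sequence c a)
    first {suc s} (j , q , c) fzero = q
    first {suc s} (j , q , c) (fsuc a) = Q-trans q (first c a)
    related : ∀ {s i} (c : Chain s i) {a b} → toℕ a < toℕ b → Q (sequence c a) (sequence c b)
    related {suc s} (j , _ , c) {fzero} {fsuc b} _ = first c b
    related {suc s} (j , _ , c) {fsuc a} {fsuc b} (s≤s lt) = related c lt

Up Down : ∀ {h} → (Fin h → Fin h) → Fin h → Fin h → Set
Up f i j = toℕ i < toℕ j × toℕ (f i) < toℕ (f j)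
Down f i j = toℕ i < toℕ j × toℕ (f j) < toℕ (f i)

up? : ∀ {h} (f : Fin h → Fin h) i j → Dec (Up f i j)
up? f i j = (toℕ i <? toℕ j) ×-dec (toℕ (f i) <? toℕ (f j))

down? : ∀ {h} (f : Fin h → Fin h) i j → Dec (Down f i j)
down? f i j = (toℕ i <? toℕ j) ×-dec (toℕ (f j) <? toℕ (f i))

-- Label each index with the lengths of the longest rising and the longest falling chain from it. If
-- all lengths were below `s`, two indices would share a label; but the earlier one can be put
-- before a chain of the later one, which makes one of its lengths larger.
erdős-szekeres : ∀ {h} s → s * s < h → (f : Fin h → Fin h) → Injective _≡_ _≡_ f →
  Σ (Fin s → Fin h) λ g → (∀ {a b} → toℕ a < toℕ b → Up f (g a) (g b)) ⊎
                          (∀ {a b} → toℕ a < toℕ b → Down f (g a) (g b))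
erdős-szekeres {h} s s²<h f f-inj with any? (chain? (up? f) s) | any? (chain? (down? f) s)
... | yes (_ , c) | _ =
  let g , rel = chain-sequence (up? f) (λ (a , b) (c , d) → <-trans a c , <-trans b d) s c in g , inj₁ rel
... | no _ | yes (_ , c) =
  let g , rel = chain-sequence (down? f) (λ (a , b) (c , d) → <-trans a c , <-trans d b) s c in g , inj₂ rel
... | no ¬up | no ¬down = ⊥-elim (clash (pigeonhole s²<h λ i → combine (proj₁ (up i)) (proj₁ (down i))))
  where
  up : ∀ i → ∃[ u ] (Chain (up? f) (toℕ {s} u) i × ¬ Chain (up? f) (suc (toℕ u)) i)
  up i = chain-length (up? f) s λ c → ¬up (i , c)
  down : ∀ i → ∃[ u ] (Chain (down? f) (toℕ {s} u) i × ¬ Chain (down? f) (suc (toℕ u)) i)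
  down i = chain-length (down? f) s λ c → ¬down (i , c)
  clash : (∃[ i ] ∃[ j ] (toℕ i < toℕ j ×
    combine (proj₁ (up i)) (proj₁ (down i)) ≡ combine (proj₁ (up j)) (proj₁ (down j)))) → ⊥
  clash (i , j , i<j , eq) with <-cmp (toℕ (f i)) (toℕ (f j))
  ... | tri≈ _ fi≡fj _ = <-irrefl (cong toℕ (f-inj (toℕ-injective fi≡fj))) i<j
  ... | tri< fi<fj _ _ = proj₂ (proj₂ (up i)) (j , (i<j , fi<fj) ,
    subst (λ u → Chain (up? f) (toℕ u) j) (sym (combine-injectiveˡ _ _ _ _ eq)) (proj₁ (proj₂ (up j))))
  ... | tri> _ _ fj<fi = proj₂ (proj₂ (down i)) (j , (i<j , fj<fi) ,
    subst (λ u → Chain (down? f) (toℕ u) j)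
      (sym (combine-injectiveʳ (proj₁ (up i)) _ (proj₁ (up j)) _ eq)) (proj₁ (proj₂ (down j))))

opposite-next : ∀ {s} {a b : Fin s} → Next a b → Next (opposite b) (opposite a)
opposite-next {s} {a} {b} next = trans (opposite-prop a)
  (trans (+-∸-assoc 1 (subst (_≤ s) (cong suc next) (toℕ<n b)))
         (cong suc (sym (trans (opposite-prop b) (cong (λ m → s ∸ suc m) next)))))

opposite-< : ∀ {s} {a b : Fin s} → toℕ a < toℕ b → toℕ (opposite b) < toℕ (opposite a)
opposite-< {s} {a} {b} a<b = subst₂ _<_ (sym (opposite-prop b)) (sym (opposite-prop a))
  (∸-monoʳ-< (s≤s a<b) (toℕ<n b))

straight-ladder : ∀ {h} s → s * s < h → {π : Fin h → Fin h} → Injective _≡_ _≡_ π →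
  Contraction (Ladder π) (Ladder {s} id)
straight-ladder s s²<h {π} π-inj with erdős-szekeres s s²<h π π-inj
... | g , inj₁ up = straighten {g = g} {π ∘ g} id (proj₁ ∘ up) (proj₂ ∘ up) id inj₁ (λ _ → refl)
-- A falling sequence rises when the right rail is traversed from its other end.
... | g , inj₂ down = straighten {g = g} {π ∘ g ∘ opposite} opposite (proj₁ ∘ down)
  (λ {a} {b} a<b → proj₂ (down (opposite-< a<b)))
  (λ {a} {b} eq → trans (sym (opposite-involutive a)) (trans (cong opposite eq) (opposite-involutive b)))
  (inj₂ ∘ opposite-next)
  (λ a → cong (π ∘ g) (opposite-involutive a))

-- Graphs of pathwidth 2 inside a ladder

data Shifted {k r : ℕ} (i : Fin k) : Pos r → Pos (k * r) → Set where
  left  : ∀ {a} → Shifted i (left a) (left (combine i a))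
  rung  : ∀ {a} → Shifted i (rung a) (rung (combine i a))
  right : ∀ {a} → Shifted i (right a) (right (combine i a))

Copies : {V : Set} (k : ℕ) → (V → V → Set) → Fin k × V → Fin k × V → Set
Copies k E (i , u) (j , v) = i ≡ j × E u v

-- `combine i` places copy `i` in the `i`-th segment of length `r` and keeps consecutive positions
-- consecutive.
copies : ∀ k {r} {V : Set} {E : V → V → Set} → Contraction (Ladder {r} id) E →
  Contraction (Ladder {k * r} id) (Copies k E)
copies k {r} {V} {E} C = record
  { fibre = fibre ; fibre? = fibre? ; nonempty = nonempty ; conn = conn ; disjoint = disjoint ; touch = touch }
  where
  module C = Contraction C
  shift : Fin k → Pos r → Pos (k * r)
  shift i (left a) = left (combine i a)
  shift i (rung a) = rung (combine i a)
  shift i (right a) = right (combine i a)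
  shift-injective : ∀ {i j} p q → shift i p ≡ shift j q → i ≡ j × p ≡ q
  shift-injective {i} {j} (left a) (left b) eq =
    let e , e′ = combine-injective i a j b (left-injective eq) in e , cong left e′
    where
    left-injective : ∀ {s} {a b : Fin s} → left a ≡ left b → a ≡ b
    left-injective refl = refl
  shift-injective {i} {j} (rung a) (rung b) eq =
    let e , e′ = combine-injective i a j b (rung-injective eq) in e , cong rung e′
    where
    rung-injective : ∀ {s} {a b : Fin s} → rung a ≡ rung b → a ≡ b
    rung-injective refl = refl
  shift-injective {i} {j} (right a) (right b) eq =
    let e , e′ = combine-injective i a j b (right-injective eq) in e , cong right e′
    where
    right-injective : ∀ {s} {a b : Fin s} → right a ≡ right b → a ≡ b
    right-injective refl = refl
  next : ∀ i {a b} → Next a b → Next (combine {k} i a) (combine i b)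
  next i {a} {b} eq = trans (toℕ-combine i b)
    (trans (cong (r * toℕ i +_) eq) (trans (+-suc _ _) (cong suc (sym (toℕ-combine i a)))))
  shift-edge : ∀ i {p q} → Ladder id p q → Ladder id (shift i p) (shift i q)
  shift-edge i (left-rail eq) = left-rail (next i eq)
  shift-edge i (right-rail eq) = right-rail (next i eq)
  shift-edge i to-left = to-left
  shift-edge i to-right = to-right
  shift-sym : ∀ i {p q} → Sym (Ladder id) p q → Sym (Ladder id) (shift i p) (shift i q)
  shift-sym i = [ inj₁ ∘ shift-edge i , inj₂ ∘ shift-edge i ]′
  fibre : Fin k × V → Pos (k * r) → Set
  fibre (i , v) q = ∃[ p ] (C.fibre v p × shift i p ≡ q)
  pos-≟ : ∀ {s} (p q : Pos s) → Dec (p ≡ q)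
  pos-≟ (left a) (left b) = map′ (cong left) (λ { refl → refl }) (a ≟ b)
  pos-≟ (rung a) (rung b) = map′ (cong rung) (λ { refl → refl }) (a ≟ b)
  pos-≟ (right a) (right b) = map′ (cong right) (λ { refl → refl }) (a ≟ b)
  pos-≟ (left _) (rung _) = no λ ()
  pos-≟ (left _) (right _) = no λ ()
  pos-≟ (rung _) (left _) = no λ ()
  pos-≟ (rung _) (right _) = no λ ()
  pos-≟ (right _) (left _) = no λ ()
  pos-≟ (right _) (rung _) = no λ ()
  fibre? : ∀ j q → Dec (fibre j q)
  fibre? (i , v) q = search-Pos λ p → C.fibre? v p ×-dec pos-≟ (shift i p) q
  nonempty : ∀ j → ∃ (fibre j)
  nonempty (i , v) = let p , f = C.nonempty v in shift i p , p , f , refl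
  conn : ∀ j → Conn (Sym (Ladder id)) (fibre j)
  conn (i , v) _ _ (p , f , refl) (q , f′ , refl) =
    walk-image (shift i) (shift-sym i) (λ f → _ , f , refl) (C.conn v p q f f′)
  disjoint : ∀ j l {q} → fibre j q → fibre l q → j ≡ l
  disjoint (i , v) (i′ , v′) (p , f , eq) (p′ , f′ , eq′) with shift-injective p p′ (trans eq (sym eq′))
  ... | refl , refl = cong (i ,_) (C.disjoint v v′ f f′)
  touch : ∀ {j l} → Copies k E j l → Touch (Sym (Ladder id)) (fibre j) (fibre l)
  touch {i , _} (refl , e) = let p , q , f , f′ , s = C.touch e in
    shift i p , shift i q , (p , f , refl) , (q , f′ , refl) , shift-sym i s

-- A linear layout of vertex separation at most 2: Active u v says that u arrives before v and still has to be
-- reachable when v arrives.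
record Elimination (r : ℕ) : Set₁ where
  field
    Active     : Fin r → Fin r → Set
    active?    : ∀ u v → Dec (Active u v)
    rank       : Fin r → ℕ
    rank<r     : ∀ v → rank v < r
    at         : ∀ {m} → m < r → Fin r
    rank-at    : ∀ {m} (lt : m < r) → rank (at lt) ≡ m
    rank-inj   : ∀ {u v} → rank u ≡ rank v → u ≡ v
    earlier    : ∀ {u v} → Active u v → rank u < rank v
    persistent : ∀ {u v w} → Active u w → rank u < rank v → rank v ≤ rank w → Active u v
    at-most-2  : ∀ {u v w x} → Active u x → Active v x → Active w x → u ≢ v → u ≢ w → v ≢ w → ⊥

  at-rank : ∀ {v m} (lt : m < r) → rank v ≡ m → at lt ≡ v
  at-rank lt eq = rank-inj (trans (rank-at lt) (sym eq))

-- Sweep the ladder from left to right.  Rung b carries the b-th vertex c in its middle, and the two rails carry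
-- all vertices that are still active at the next arrival.  If c itself is still active then, some rail vertex is
-- not, and c takes over its rail from rung b on.
module Sweep {r : ℕ} (El : Elimination (suc r)) where
  open Elimination El

  Rails : Set
  Rails = Fin (suc r) × Fin (suc r)

  -- `c` sits on the current rung and `d` arrives next. If `c` and `p` are both active at `d`, then
  -- `q` is inactive or equal to `p`, so its rail can be given to `c`.
  update : (c d : Fin (suc r)) → Rails → Rails
  update c d (p , q) with active? c d | active? p d
  ... | no _ | _ = p , q
  ... | yes _ | no _ = c , q
  ... | yes _ | yes _ = p , c

  vertex : ℕ → Fin (suc r)
  vertex m with m <? suc r
  ... | yes lt = at lt
  -- On the ladder this value only plays the successor of the last vertex. Any vertex will do, as
  -- the rails must cover the active vertices only up to the last arrival.
  ... | no _ = fzero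

  rails : ℕ → Rails
  -- Both rails start out with the first vertex, so that every position carries a label.
  rails zero = vertex 0 , vertex 0
  rails (suc b) = update (vertex (suc b)) (vertex (suc (suc b))) (rails b)

  vertex-rank : ∀ v → vertex (rank v) ≡ v
  vertex-rank v with rank v <? suc r
  ... | yes lt = at-rank lt refl
  ... | no ≮ = ⊥-elim (≮ (rank<r v))

  rank-vertex : ∀ {m} → m < suc r → rank (vertex m) ≡ m
  rank-vertex {m} lt with m <? suc r
  ... | yes lt′ = rank-at lt′
  ... | no ≮ = ⊥-elim (≮ lt)

  update-fst : ∀ c d pq → proj₁ (update c d pq) ≡ proj₁ pq ⊎ proj₁ (update c d pq) ≡ c
  update-fst c d (p , q) with active? c d | active? p d
  ... | no _ | _ = inj₁ refl
  ... | yes _ | no _ = inj₂ refl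
  ... | yes _ | yes _ = inj₁ refl

  update-snd : ∀ c d pq → proj₂ (update c d pq) ≡ proj₂ pq ⊎ proj₂ (update c d pq) ≡ c
  update-snd c d (p , q) with active? c d | active? p d
  ... | no _ | _ = inj₁ refl
  ... | yes _ | no _ = inj₁ refl
  ... | yes _ | yes _ = inj₂ refl

  _∈ᵣ_ : Fin (suc r) → Rails → Set
  u ∈ᵣ (p , q) = u ≡ p ⊎ u ≡ q

  update-covers : ∀ c d p q → c ≢ p → c ≢ q → ∀ u → Active u d → u ≡ c ⊎ u ∈ᵣ (p , q) →
    u ∈ᵣ update c d (p , q)
  update-covers c d p q c≢p c≢q u act u∈ with active? c d | active? p d
  update-covers c d p q c≢p c≢q u act (inj₁ refl) | no ¬c | _ = ⊥-elim (¬c act)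
  update-covers c d p q c≢p c≢q u act (inj₂ u∈) | no ¬c | _ = u∈
  update-covers c d p q c≢p c≢q u act (inj₁ refl) | yes _ | no _ = inj₁ refl
  update-covers c d p q c≢p c≢q u act (inj₂ (inj₁ refl)) | yes _ | no ¬p = ⊥-elim (¬p act)
  update-covers c d p q c≢p c≢q u act (inj₂ (inj₂ refl)) | yes _ | no _ = inj₂ refl
  update-covers c d p q c≢p c≢q u act (inj₁ refl) | yes _ | yes _ = inj₂ refl
  update-covers c d p q c≢p c≢q u act (inj₂ (inj₁ refl)) | yes _ | yes _ = inj₁ refl
  -- A displaced `q` that is still active would be a third active vertex besides `c` and `p`, unless
  -- it equals `p`.
  update-covers c d p q c≢p c≢q u act (inj₂ (inj₂ refl)) | yes ac | yes ap with u ≟ p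
  ... | yes refl = inj₁ refl
  ... | no u≢p = ⊥-elim (at-most-2 ac ap act c≢p c≢q (u≢p ∘ sym))

  rails-rank : ∀ b → b < suc r → rank (proj₁ (rails b)) ≤ b × rank (proj₂ (rails b)) ≤ b
  rails-rank zero lt = ≤-reflexive (rank-vertex lt) , ≤-reflexive (rank-vertex lt)
  rails-rank (suc b) lt =
    let p≤ , q≤ = rails-rank b (<-trans (n<1+n b) lt)
        c = vertex (suc b)
        d = vertex (suc (suc b))
    in bound p≤ (update-fst c d (rails b)) , bound q≤ (update-snd c d (rails b))
    where
    bound : ∀ {p p′} → rank p ≤ b → p′ ≡ p ⊎ p′ ≡ vertex (suc b) → rank p′ ≤ suc b
    bound p≤ (inj₁ refl) = m≤n⇒m≤1+n p≤
    bound p≤ (inj₂ refl) = ≤-reflexive (rank-vertex lt)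

  rails-cover : ∀ b → suc b < suc r → ∀ u → Active u (vertex (suc b)) → u ∈ᵣ rails b
  rails-cover zero lt u act = inj₁ (rank-inj (trans
    (n<1⇒n≡0 (<-≤-trans (earlier act) (≤-reflexive (rank-vertex lt))))
    (sym (rank-vertex (s≤s z≤n)))))
  rails-cover (suc b) lt u act =
    let p≤ , q≤ = rails-rank b (<-trans (n<1+n b) lt′)
    in update-covers (vertex (suc b)) (vertex (suc (suc b))) _ _ (later p≤) (later q≤) u act (old-or-new (u ≟ vertex (suc b)))
    where
    lt′ : suc b < suc r
    lt′ = <-trans (n<1+n _) lt
    later : ∀ {p} → rank p ≤ b → vertex (suc b) ≢ p
    later p≤ refl = <⇒≱ (n<1+n b) (≤-trans (≤-reflexive (sym (rank-vertex lt′))) p≤)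
    old-or-new : Dec (u ≡ vertex (suc b)) → u ≡ vertex (suc b) ⊎ u ∈ᵣ rails b
    old-or-new (yes eq) = inj₁ eq
    -- Here `u` is older than `vertex (suc b)`, so by persistence it was already active there, and
    -- induction finds it on a rail.
    old-or-new (no u≢) = inj₂ (rails-cover b lt′ u (persistent act
      (≤∧≢⇒< (s≤s⁻¹ (<-≤-trans (earlier act) (≤-reflexive (trans (rank-vertex lt) (cong suc (sym (rank-vertex lt′)))))))
        (u≢ ∘ rank-inj))
      (≤-trans (≤-reflexive (rank-vertex lt′)) (≤-trans (n≤1+n _) (≤-reflexive (sym (rank-vertex lt)))))))

  label : Pos (suc r) → Fin (suc r)
  label (left a) = proj₁ (rails (toℕ a))
  label (rung a) = vertex (toℕ a)
  label (right a) = proj₂ (rails (toℕ a))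

  home : Fin (suc r) → Pos (suc r)
  home v = rung (fromℕ< (rank<r v))

  label-home : ∀ v → label (home v) ≡ v
  label-home v = trans (cong vertex (toℕ-fromℕ< (rank<r v))) (vertex-rank v)

  home-vertex : ∀ a → home (vertex (toℕ a)) ≡ rung a
  home-vertex a = cong rung (toℕ-injective (trans (toℕ-fromℕ< _) (rank-vertex (toℕ<n a))))

  E : Pos (suc r) → Pos (suc r) → Set
  E = Sym (Ladder id)

  E-sym : ∀ {p q} → E p q → E q p
  E-sym = Sym-sym {E = Ladder id}

  Labelled : Fin (suc r) → Pos (suc r) → Set
  Labelled v p = label p ≡ v

  -- A label enters a rail only next to the rung of its own vertex and then stays for an interval.
  -- Walking back along the rail reaches that rung.
  rail-home : (side : Fin (suc r) → Pos (suc r)) → (∀ {a b} → Next a b → E (side a) (side b)) →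
    (∀ {a} → E (side a) (rung a)) → label (side fzero) ≡ vertex 0 →
    (∀ a b → Next a b → label (side b) ≡ label (side a) ⊎ label (side b) ≡ vertex (toℕ b)) →
    ∀ v a → Labelled v (side a) → Walk E (Labelled v) (side a) (home v)
  rail-home side next in-rung start back v a = go (<-wellFounded (toℕ a)) a refl
    where
    at-rung : ∀ a → Labelled v (side a) → label (side a) ≡ vertex (toℕ a) → Walk E (Labelled v) (side a) (home v)
    at-rung a eq eq′ = step eq in-rung (subst (Walk E (Labelled v) (rung a))
      (trans (sym (home-vertex a)) (cong home va≡v)) (here va≡v))
      where
      va≡v : vertex (toℕ a) ≡ v
      va≡v = trans (sym eq′) eq
    go : ∀ {m} → Acc _<_ m → ∀ a → toℕ a ≡ m → Labelled v (side a) → Walk E (Labelled v) (side a) (home v)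
    go _ fzero _ eq = at-rung fzero eq start
    go (acc smaller) (fsuc a) refl eq with back (inject₁ a) (fsuc a) (cong suc (sym (toℕ-inject₁ a)))
    ... | inj₂ eq′ = at-rung (fsuc a) eq eq′
    ... | inj₁ eq′ = step eq (E-sym (next (cong suc (sym (toℕ-inject₁ a)))))
      (go (smaller (s≤s (≤-reflexive (toℕ-inject₁ a)))) (inject₁ a) refl (trans (sym eq′) eq))

  step-back-fst : ∀ (a b : Fin (suc r)) → Next a b →
    proj₁ (rails (toℕ b)) ≡ proj₁ (rails (toℕ a)) ⊎ proj₁ (rails (toℕ b)) ≡ vertex (toℕ b)
  step-back-fst a b eq with toℕ b
  step-back-fst a b refl | _ = update-fst _ (vertex (suc (suc (toℕ a)))) (rails (toℕ a))

  step-back-snd : ∀ (a b : Fin (suc r)) → Next a b →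
    proj₂ (rails (toℕ b)) ≡ proj₂ (rails (toℕ a)) ⊎ proj₂ (rails (toℕ b)) ≡ vertex (toℕ b)
  step-back-snd a b eq with toℕ b
  step-back-snd a b refl | _ = update-snd _ (vertex (suc (suc (toℕ a)))) (rails (toℕ a))

  go-home : ∀ v p → Labelled v p → Walk E (Labelled v) p (home v)
  go-home v (left a) = rail-home left (inj₁ ∘ left-rail) (inj₂ to-left) refl step-back-fst v a
  go-home v (right a) = rail-home right (inj₁ ∘ right-rail) (inj₂ to-right) refl step-back-snd v a
  go-home v (rung a) refl = subst (Walk E (Labelled v) (rung a)) (sym (home-vertex a)) (here refl)

  -- Either `u` keeps its rail and touches the new vertex across the rung of `b`, or the new vertex
  -- takes over that rail and the two touch along it.
  meets : ∀ (a b : Fin (suc r)) → Next a b → ∀ {u} → u ∈ᵣ rails (toℕ a) →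
    Touch E (Labelled u) (Labelled (vertex (toℕ b)))
  meets a b next (inj₁ refl) with step-back-fst a b next
  ... | inj₁ eq = left b , rung b , eq , refl , inj₂ to-left
  ... | inj₂ eq = left a , left b , refl , eq , inj₁ (left-rail next)
  meets a b next (inj₂ refl) with step-back-snd a b next
  ... | inj₁ eq = right b , rung b , eq , refl , inj₂ to-right
  ... | inj₂ eq = right a , right b , refl , eq , inj₁ (right-rail next)

  touch-active : ∀ {u v} → Active u v → Touch E (Labelled u) (Labelled v)
  touch-active {u} {v} act = go (rank v) refl
    where
    go : ∀ m → rank v ≡ m → Touch E (Labelled u) (Labelled v)
    go zero eq = ⊥-elim (n≮0 (subst (rank u <_) eq (earlier act)))
    go (suc m) eq = subst (λ w → Touch E (Labelled u) (Labelled w)) vb≡v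
      (meets a b next (subst (λ l → u ∈ᵣ rails l) (sym toℕa) (rails-cover m lt u (subst (Active u) (sym v≡) act))))
      where
      lt : suc m < suc r
      lt = subst (_< suc r) eq (rank<r v)
      a b : Fin (suc r)
      a = fromℕ< (<-trans (n<1+n m) lt)
      b = fromℕ< lt
      toℕa : toℕ a ≡ m
      toℕa = toℕ-fromℕ< (<-trans (n<1+n m) lt)
      next : Next a b
      next = trans (toℕ-fromℕ< lt) (cong suc (sym toℕa))
      v≡ : vertex (suc m) ≡ v
      v≡ = trans (cong vertex (sym eq)) (vertex-rank v)
      vb≡v : vertex (toℕ b) ≡ v
      vb≡v = trans (cong vertex (toℕ-fromℕ< lt)) v≡

  sweep : Contraction (Ladder {suc r} id) (Sym Active)
  sweep = record
    { fibre = Labelled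
    ; fibre? = λ v p → label p ≟ v
    ; nonempty = λ v → home v , label-home v
    ; conn = λ v → conn-centre (home v) (go-home v)
    ; disjoint = λ u v eq eq′ → trans (sym eq) eq′
    ; touch = λ { (inj₁ act) → touch-active act
                ; (inj₂ act) → let p , q , p∈ , q∈ , e = touch-active act in q , p , q∈ , p∈ , E-sym e }
    }

-- From a path-decomposition to a linear layout

least : ∀ {m} {P : Fin m → Set} → (∀ i → Dec (P i)) → ∃ P → ∃[ i ] (P i × (∀ j → P j → toℕ i ≤ toℕ j))
least {suc m} {P} P? (i , pi) with P? fzero
... | yes p0 = fzero , p0 , λ _ _ → z≤n
... | no ¬p0 with least (P? ∘ fsuc) (witness i pi)
  where
  witness : ∀ i → P i → ∃ (P ∘ fsuc)
  witness fzero p = ⊥-elim (¬p0 p)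
  witness (fsuc i) p = i , p
... | j , pj , min = fsuc j , pj , λ { fzero p → ⊥-elim (¬p0 p) ; (fsuc l) p → s≤s (min l p) }

4≤∣p∣ : ∀ {n} {p : Subset n} {u v w x} → u ∈ p → v ∈ p → w ∈ p → x ∈ p →
  u ≢ v → u ≢ w → u ≢ x → v ≢ w → v ≢ x → w ≢ x → 4 ≤ ∣ p ∣
4≤∣p∣ {p = p} {u} {v} {w} {x} u∈ v∈ w∈ x∈ uv uw ux vw vx wx =
  ≤-trans (s≤s (≤-trans (s≤s (≤-trans (s≤s (nonempty⇒0<∣p∣ x∈₃)) (x∈p⇒∣p-x∣<∣p∣ w∈₂))) (x∈p⇒∣p-x∣<∣p∣ v∈₁)))
    (x∈p⇒∣p-x∣<∣p∣ u∈)
  where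
  v∈₁ : v ∈ p - u
  v∈₁ = x∈p∧x≢y⇒x∈p-y v∈ (uv ∘ sym)
  w∈₂ : w ∈ p - u - v
  w∈₂ = x∈p∧x≢y⇒x∈p-y (x∈p∧x≢y⇒x∈p-y w∈ (uw ∘ sym)) (vw ∘ sym)
  x∈₃ : x ∈ p - u - v - w
  x∈₃ = x∈p∧x≢y⇒x∈p-y (x∈p∧x≢y⇒x∈p-y (x∈p∧x≢y⇒x∈p-y x∈ (ux ∘ sym)) (vx ∘ sym)) (wx ∘ sym)

module FromPathDecomposition {H : Graph} (PD : PathDecomposition H 2) where
  open PathDecomposition PD renaming (m to bags)

  V = Fin (n H)

  first : V → Fin bags
  first v = proj₁ (least (λ i → v ∈? bag i) (cover-v v))

  ∈first : ∀ v → v ∈ bag (first v)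
  ∈first v = proj₁ (proj₂ (least (λ i → v ∈? bag i) (cover-v v)))

  first-least : ∀ {v i} → v ∈ bag i → toℕ (first v) ≤ toℕ i
  first-least {v} = proj₂ (proj₂ (least (λ i → v ∈? bag i) (cover-v v))) _

  -- Vertices are ordered by the first bag containing them, ties being broken by their number;
  -- `combine` gives the lexicographic order.
  key : V → Fin (bags * n H)
  key v = combine (first v) v

  key-injective : ∀ {u v} → toℕ (key u) ≡ toℕ (key v) → u ≡ v
  key-injective {u} {v} eq = combine-injectiveʳ (first u) u (first v) v (toℕ-injective eq)

  first-mono : ∀ {u v} → toℕ (key u) ≤ toℕ (key v) → toℕ (first u) ≤ toℕ (first v)
  first-mono {u} {v} ≤key with toℕ (first v) <? toℕ (first u)
  ... | yes lt = ⊥-elim (<⇒≱ (combine-monoˡ-< v u lt) ≤key)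
  ... | no ≮ = ≮⇒≥ ≮

  before? : ∀ v u → Dec (toℕ (key u) < toℕ (key v))
  before? v u = toℕ (key u) <? toℕ (key v)

  before : V → Subset (n H)
  before v = comprehension (before? v)

  rank : V → ℕ
  rank v = ∣ before v ∣

  rank-mono : ∀ {u v} → toℕ (key u) < toℕ (key v) → rank u < rank v
  rank-mono {u} {v} lt = p⊂q⇒∣p∣<∣q∣
    ( (λ x∈ → ∈-comprehension⁺ (before? v) (<-trans (∈-comprehension⁻ (before? u) x∈) lt))
    , u , ∈-comprehension⁺ (before? v) lt , λ u∈ → <-irrefl refl (∈-comprehension⁻ (before? u) u∈) )

  rank-reflects-≤ : ∀ {u v} → rank u ≤ rank v → toℕ (key u) ≤ toℕ (key v)
  rank-reflects-≤ {u} {v} le with toℕ (key v) <? toℕ (key u)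
  ... | yes lt = ⊥-elim (<⇒≱ (rank-mono lt) le)
  ... | no ≮ = ≮⇒≥ ≮

  rank-injective : ∀ {u v} → rank u ≡ rank v → u ≡ v
  rank-injective eq =
    key-injective (≤-antisym (rank-reflects-≤ (≤-reflexive eq)) (rank-reflects-≤ (≤-reflexive (sym eq))))

  rank<n : ∀ v → rank v < n H
  rank<n v = <-≤-trans (p⊂q⇒∣p∣<∣q∣
    ((λ _ → ∈⊤) , v , ∈⊤ , λ v∈ → <-irrefl refl (∈-comprehension⁻ (before? v) v∈))) (≤-reflexive (∣⊤∣≡n (n H)))

  inverse : ∀ {m} (lt : m < n H) → ∃[ v ] fromℕ< (rank<n v) ≡ fromℕ< lt
  inverse lt = proj₂ (proj₂ (injective⇒Enumerates {f = λ v → fromℕ< (rank<n v)}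
    (λ {u} {v} eq → rank-injective (trans (sym (toℕ-fromℕ< (rank<n u))) (trans (cong toℕ eq) (toℕ-fromℕ< (rank<n v)))))
    (λ _ → ∈⊤) (≤-reflexive (∣⊤∣≡n (n H))))) ∈⊤

  -- The first bag of `v` has at most three vertices and `v` is one of them, which leaves room for
  -- two active ones.
  Active : V → V → Set
  Active u v = rank u < rank v × u ∈ bag (first v)

  distinct : ∀ {u v} → rank u < rank v → u ≢ v
  distinct lt refl = <-irrefl refl lt

  elimination : Elimination (n H)
  elimination = record
    { Active = Active
    ; active? = λ u v → (rank u <? rank v) ×-dec (u ∈? bag (first v))
    ; rank = rank
    ; rank<r = rank<n
    ; at = λ lt → proj₁ (inverse lt)
    ; rank-at = λ lt → trans (sym (toℕ-fromℕ< (rank<n _))) (trans (cong toℕ (proj₂ (inverse lt))) (toℕ-fromℕ< lt))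
    ; rank-inj = rank-injective
    ; earlier = proj₁
    ; persistent = λ {u} {v} {w} (_ , u∈) u<v v≤w → u<v , interp u (first u) (first v) (first w)
        (first-mono (rank-reflects-≤ (<⇒≤ u<v))) (first-mono (rank-reflects-≤ v≤w)) (∈first u) u∈
    ; at-most-2 = λ {u} {v} {w} {x} (u<x , u∈) (v<x , v∈) (w<x , w∈) uv uw vw →
        <⇒≱ (n<1+n 3) (≤-trans (4≤∣p∣ u∈ v∈ w∈ (∈first x) uv uw (distinct u<x) vw (distinct v<x) (distinct w<x))
          (width (first x)))
    }

  -- The earlier end appears no later than the other end first does, and both share some bag from
  -- there on; by interpolation it lies in the first bag of the other end.
  edge-active : ∀ {u v} → Edge H u v → Sym Active u v
  edge-active {u} {v} e with <-cmp (rank u) (rank v)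
  ... | tri< u<v _ _ = inj₁ (u<v , common u<v)
    where
    common : rank u < rank v → u ∈ bag (first v)
    common u<v = let i , u∈ , v∈ = cover-e u v e in
      interp u (first u) (first v) i (first-mono (rank-reflects-≤ (<⇒≤ u<v))) (first-least v∈) (∈first u) u∈
  ... | tri> _ _ v<u = inj₂ (v<u , common v<u)
    where
    common : rank v < rank u → v ∈ bag (first u)
    common v<u = let i , u∈ , v∈ = cover-e u v e in
      interp v (first v) (first u) i (first-mono (rank-reflects-≤ (<⇒≤ v<u))) (first-least u∈) (∈first v) v∈
  ... | tri≈ _ eq _ with rank-injective eq
  ... | refl with trans (sym e) (irrefl H u)
  ... | ()

ladder-contains : ∀ {H} → PathwidthAtMost H 2 → 0 < n H → Contraction (Ladder {n H} id) (Edge H)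
ladder-contains {H} PD 0<n = go (n H) refl 0<n
  where
  open FromPathDecomposition PD
  go : ∀ r → n H ≡ r → 0 < r → Contraction (Ladder {n H} id) (Edge H)
  go (suc r) eq _ = record
    { fibre = C.fibre ; fibre? = C.fibre? ; nonempty = C.nonempty ; conn = C.conn ; disjoint = C.disjoint
    ; touch = C.touch ∘ edge-active }
    where
    -- `Sweep` expects a successor as the number of vertices, and `n H` is only propositionally
    -- equal to one.
    sweep′ : ∀ {q} → q ≡ suc r → (El : Elimination q) → Contraction (Ladder {q} id) (Sym (Elimination.Active El))
    sweep′ refl El = Sweep.sweep El
    module C = Contraction (sweep′ eq elimination)

-- Tree-decompositions

walk⇒WalkIn : ∀ {G : Graph} {S : Fin (n G) → Set} {u v} → Walk (Edge G) S u v → WalkIn G S u v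
walk⇒WalkIn (here s) = here s
walk⇒WalkIn (step s e p) = step s e (walk⇒WalkIn p)

walkIn⇒Walk : ∀ {G : Graph} {S : Fin (n G) → Set} {u v} → WalkIn G S u v → Walk (Edge G) S u v
walkIn⇒Walk (here s) = here s
walkIn⇒Walk (step s e p) = step s e (walkIn⇒Walk p)

Edge-sym : ∀ G {u v} → Edge G u v → Edge G v u
Edge-sym G {u} {v} e = trans (adj-sym G v u) e

add-leaf : (T : Graph) → Fin (n T) → Graph
add-leaf T p = record { n = suc (n T) ; adj = adj′ ; sym = sym′ ; irrefl = irrefl′ }
  where
  adj′ : Fin (suc (n T)) → Fin (suc (n T)) → Bool
  adj′ fzero fzero = false
  adj′ fzero (fsuc j) = does (j ≟ p)
  adj′ (fsuc i) fzero = does (i ≟ p)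
  adj′ (fsuc i) (fsuc j) = adj T i j
  sym′ : ∀ u v → adj′ u v ≡ adj′ v u
  sym′ fzero fzero = refl
  sym′ fzero (fsuc j) = refl
  sym′ (fsuc i) fzero = refl
  sym′ (fsuc i) (fsuc j) = adj-sym T i j
  irrefl′ : ∀ v → adj′ v v ≡ false
  irrefl′ fzero = refl
  irrefl′ (fsuc i) = irrefl T i

add-leaf-conn : ∀ T p {S : Fin (suc (n T)) → Set} → Conn (Edge T) (S ∘ fsuc) →
  (S fzero → ∀ j → S (fsuc j) → S (fsuc p)) → Conn (Edge (add-leaf T p)) S
add-leaf-conn T p {S} inner outer = go
  where
  lift : ∀ {u v} → Walk (Edge T) (S ∘ fsuc) u v → Walk (Edge (add-leaf T p)) S (fsuc u) (fsuc v)
  lift = walk-image fsuc id id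
  go : Conn (Edge (add-leaf T p)) S
  go fzero fzero su _ = here su
  go fzero (fsuc j) su sv = step su (dec-true (p ≟ p) refl) (lift (inner p j (outer su j sv) sv))
  go (fsuc i) fzero su sv =
    walk-trans (lift (inner i p su (outer sv i su)))
      (step (outer sv i su) (dec-true (p ≟ p) refl) (here sv))
  go (fsuc i) (fsuc j) su sv = lift (inner i j su sv)

leaf-neighbour : ∀ T p {x} → Edge (add-leaf T p) fzero x → x ≡ fsuc p
leaf-neighbour T p {fsuc j} e with j ≟ p
... | yes refl = refl

-- A vertex of a cycle has two distinct neighbours on it, while the new leaf has a single neighbour.
-- Hence a cycle avoids the leaf and lies in `T`.
add-leaf-acyclic : ∀ T p → ¬ HasCycle T → ¬ HasCycle (add-leaf T p)
add-leaf-acyclic T p acyclic (m , c , c-inj , along , close) = acyclic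
  (m , c′ , (λ {i} {j} eq → c-inj (trans (c≡ i) (trans (cong fsuc eq) (sym (c≡ j)))))
    , (λ i → subst₂ (Edge (add-leaf T p)) (c≡ (inject₁ i)) (c≡ (fsuc i)) (along i))
    , subst₂ (Edge (add-leaf T p)) (c≡ (fromℕ (suc (suc m)))) (c≡ fzero) close)
  where
  E-sym : ∀ i j → Edge (add-leaf T p) (c i) (c j) → Edge (add-leaf T p) (c j) (c i)
  E-sym i j = Edge-sym (add-leaf T p) {c i} {c j}
  two-neighbours : ∀ {i j k} → c i ≡ fzero → Edge (add-leaf T p) (c i) (c j) → Edge (add-leaf T p) (c i) (c k) → j ≡ k
  two-neighbours {j = j} {k} eq e e′ = c-inj (trans
    (leaf-neighbour T p (subst (λ x → Edge (add-leaf T p) x (c j)) eq e))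
    (sym (leaf-neighbour T p (subst (λ x → Edge (add-leaf T p) x (c k)) eq e′))))
  avoids : ∀ i → c i ≢ fzero
  avoids i eq with view i
  ... | ‵fromℕ with two-neighbours {fsuc last} {inject₁ last} {fzero} eq
            (E-sym (inject₁ last) (fsuc last) (along last)) close
    where last = fromℕ (suc m)
  ... | ()
  avoids i eq | ‵inject₁ fzero
    with two-neighbours {fzero} {fsuc fzero} {fromℕ (suc (suc m))} eq
      (along fzero) (E-sym (fromℕ (suc (suc m))) fzero close)
  ... | ()
  avoids i eq | ‵inject₁ (fsuc j) = <-irrefl (sym (cong toℕ
      (two-neighbours {fsuc (inject₁ j)} {fsuc (fsuc j)} {inject₁ (inject₁ j)} eq
        (along (fsuc j)) (E-sym (inject₁ (inject₁ j)) (fsuc (inject₁ j)) (along (inject₁ j))))))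
    (≤-trans (s≤s (≤-reflexive (trans (toℕ-inject₁ (inject₁ j)) (toℕ-inject₁ j)))) (n≤1+n _))
  c′ : Fin (suc (suc (suc m))) → Fin (n T)
  c′ i with c i | avoids i
  ... | fzero | ne = ⊥-elim (ne refl)
  ... | fsuc x | _ = x
  c≡ : ∀ i → c i ≡ fsuc (c′ i)
  c≡ i with c i | avoids i
  ... | fzero | ne = ⊥-elim (ne refl)
  ... | fsuc x | _ = refl

add-leaf-tree : ∀ T p → IsTree T → IsTree (add-leaf T p)
add-leaf-tree T p (_ , connected , acyclic) = s≤s z≤n ,
  (λ u v _ _ → walk⇒WalkIn (add-leaf-conn T p (λ u v _ _ → walkIn⇒Walk (connected u v _ _)) (λ _ _ _ → tt) u v tt tt)) ,
  add-leaf-acyclic T p acyclic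

-- A tree-decomposition in the making: unlike in TreeDecomposition, the bags need not cover the graph.
record Partial (m W : ℕ) : Set where
  field
    T        : Graph
    tree     : IsTree T
    bag      : Fin (n T) → Subset m
    coherent : ∀ v → Conn (Edge T) (λ t → v ∈ bag t)
    width    : ∀ t → ∣ bag t ∣ ≤ W

Node : ∀ {m W} → Partial m W → Set
Node D = Fin (n (Partial.T D))

singleton : ∀ {m W} → Partial m W
singleton {m} = record
  { T = record { n = 1 ; adj = λ _ _ → false ; sym = λ _ _ → refl ; irrefl = λ _ → refl }
  ; tree = s≤s z≤n , (λ { fzero fzero _ _ → here tt }) , λ { (_ , c , c-inj , _) → one-point c c-inj }
  ; bag = λ _ → ⊥ˢ ; coherent = λ { _ fzero fzero v∈ _ → here v∈ }
  ; width = λ _ → ≤-trans (≤-reflexive (∣⊥∣≡0 m)) z≤n }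
  where
  one-point : ∀ {m} (c : Fin (suc (suc (suc m))) → Fin 1) → Injective _≡_ _≡_ c → ⊥
  one-point c c-inj with injective⇒≤ c-inj
  ... | s≤s ()

attach : ∀ {m W} (D : Partial m W) (p : Node D) (b : Subset m) → ∣ b ∣ ≤ W →
  (∀ {v j} → v ∈ b → v ∈ Partial.bag D j → v ∈ Partial.bag D p) → Partial m W
attach D p b ∣b∣≤W fresh = record
  { T = add-leaf T p ; tree = add-leaf-tree T p tree ; bag = bag′
  ; coherent = λ v → add-leaf-conn T p (coherent v) (λ v∈b j v∈j → fresh v∈b v∈j)
  ; width = λ { fzero → ∣b∣≤W ; (fsuc j) → width j } }
  where
  open Partial D
  bag′ : Fin (suc (n T)) → Subset _
  bag′ fzero = b
  bag′ (fsuc j) = bag j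

-- The old nodes survive with their bags, so a second part can be attached to the result for the
-- first; `used` ensures that the first introduced only vertices of its own part.
record Extension {m W : ℕ} (R : Fin m → Fin m → Set) (D : Partial m W) (B : Subset m) : Set where
  field
    result  : Partial m W
  open Partial D
  open Partial result renaming (T to T′; bag to bag′) using ()
  field
    embed   : Node D → Node result
    same    : ∀ j → bag′ (embed j) ≡ bag j
    used    : ∀ {x j} → x ∈ bag′ j → (∃[ i ] x ∈ bag i) ⊎ x ∈ B
    cover-v : ∀ {x} → x ∈ B → ∃[ j ] x ∈ bag′ j
    cover-e : ∀ {u v} → R u v → u ∈ B → v ∈ B → ∃[ j ] (u ∈ bag′ j × v ∈ bag′ j)

-- The subgraph induced on `B`, kept on the full vertex type so that subsets need no relabelling;
-- vertices outside `B` become isolated.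
Restricted : ∀ {m} → (Fin m → Fin m → Set) → Subset m → Fin m → Fin m → Set
Restricted R B u v = R u v × u ∈ B × v ∈ B

well-linked? : ∀ {m} {R : Fin m → Fin m → Set} → (∀ u v → Dec (R u v)) → ∀ Z N →
  WellLinked R Z N ⊎ (∃[ P ] ∃[ Q ] (Separation R P Q × ∣ P ∩ Q ∣ ≤ N × ¬ Big Z N P × ¬ Big Z N Q))
well-linked? R? Z N with anySubset? (λ P → anySubset? (λ Q →
  separation? R? P Q ×-dec (∣ P ∩ Q ∣ ≤? N) ×-dec ¬? (∣ Z ∣ <? ∣ Z ∩ P ∣ + N) ×-dec ¬? (∣ Z ∣ <? ∣ Z ∩ Q ∣ + N)))
... | yes found = inj₂ found
... | no none = inj₁ linked
  where
  linked : WellLinked _ Z N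
  linked P Q sep order with ∣ Z ∣ <? ∣ Z ∩ P ∣ + N | ∣ Z ∣ <? ∣ Z ∩ Q ∣ + N
  ... | yes bigP | _ = inj₁ bigP
  ... | no _ | yes bigQ = inj₂ bigQ
  ... | no ¬P | no ¬Q = ⊥-elim (none (P , Q , sep , order , ¬P , ¬Q))

-- Robertson and Seymour's recursion.  The border Z of the part B still to be decomposed lies in a bag of D; it grows
-- one vertex at a time up to size M, and is then balanced by a separation of order at most N.
module Decompose {m : ℕ} {R : Fin m → Fin m → Set} (R? : ∀ u v → Dec (R u v)) (R-sym : ∀ {u v} → R u v → R v u)
  {M N : ℕ} (0<N : 0 < N) (unlinked : ∀ B Z → ∣ Z ∣ ≡ M → ¬ WellLinked (Restricted R B) Z N) where

  W = M + N

  -- `B` meets the bags built so far only in `Z`, and `Z` sits inside the bag of `p`; nodes attached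
  -- at `p` then preserve coherence.
  Border : (D : Partial m W) → Node D → (Z B : Subset m) → Set
  Border D p Z B = Z ⊆ B × Z ⊆ Partial.bag D p × (∀ {j x} → x ∈ Partial.bag D j → x ∈ B → x ∈ Z)

  restricted? : ∀ B u v → Dec (Restricted R B u v)
  restricted? B u v = R? u v ×-dec (u ∈? B) ×-dec (v ∈? B)

  trivial : (D : Partial m W) (p : Node D) {Z B : Subset m} → Border D p Z B → B ⊆ Z → Extension R D B
  trivial D p (_ , Z⊆p , _) B⊆Z = record
    { result = D ; embed = id ; same = λ _ → refl ; used = λ x∈ → inj₁ (_ , x∈)
    ; cover-v = λ x∈ → p , Z⊆p (B⊆Z x∈) ; cover-e = λ _ u∈ v∈ → p , Z⊆p (B⊆Z u∈) , Z⊆p (B⊆Z v∈) }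

  enlarge : (D : Partial m W) (p : Node D) {Z B : Subset m} → Border D p Z B → ∣ Z ∣ < M → ∀ {v} → v ∈ B → v ∉ Z →
    (∀ D′ p′ → Border D′ p′ (Z ∪ ⁅ v ⁆) B → ∣ Z ∪ ⁅ v ⁆ ∣ ≤ M → Extension R D′ B) → Extension R D B
  enlarge D p {Z} {B} (Z⊆B , Z⊆p , used⊆Z) Z<M {v} v∈B v∉Z rec = record
    { result = E.result ; embed = E.embed ∘ fsuc ; same = E.same ∘ fsuc
    ; used = λ x∈ → [ old-or-B , inj₂ ]′ (E.used x∈)
    ; cover-v = E.cover-v ; cover-e = E.cover-e }
    where
    Z′ = Z ∪ ⁅ v ⁆
    Z′⊆B : Z′ ⊆ B
    Z′⊆B x∈ = [ Z⊆B , (λ x∈v → subst (_∈ B) (sym (x∈⁅y⁆⇒x≡y v x∈v)) v∈B) ]′ (x∈p∪q⁻ Z ⁅ v ⁆ x∈)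
    ∣Z′∣≤M : ∣ Z′ ∣ ≤ M
    ∣Z′∣≤M = ≤-trans (∣p∣≤∣q∣+∣r∣ (x∈p∪q⁻ Z ⁅ v ⁆))
      (subst (_≤ M) (trans (+-comm 1 ∣ Z ∣) (cong (∣ Z ∣ +_) (sym (∣⁅x⁆∣≡1 v)))) Z<M)
    D′ : Partial m W
    D′ = attach D p Z′ (≤-trans ∣Z′∣≤M (m≤m+n M N)) λ x∈ x∈j → Z⊆p (used⊆Z x∈j (Z′⊆B x∈))
    used⊆Z′ : ∀ {j x} → x ∈ Partial.bag D′ j → x ∈ B → x ∈ Z′
    used⊆Z′ {fzero} x∈ _ = x∈
    used⊆Z′ {fsuc j} x∈ x∈B = p⊆p∪q ⁅ v ⁆ (used⊆Z x∈ x∈B)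
    extension : Extension R D′ B
    extension = rec D′ fzero (Z′⊆B , id , λ {j} → used⊆Z′ {j}) ∣Z′∣≤M
    module E = Extension extension
    old-or-B : ∀ {x} → (∃[ i ] x ∈ Partial.bag D′ i) → (∃[ i ] x ∈ Partial.bag D i) ⊎ x ∈ B
    old-or-B (fzero , x∈) = inj₂ (Z′⊆B x∈)
    old-or-B (fsuc i , x∈) = inj₁ (i , x∈)

  -- Neither side is big, so `Z` has at most `M - N` vertices in each, and adding the separator
  -- keeps both new borders within `M`. The bag of `Z` with the separator serves both recursive
  -- calls as the node to attach to.
  split : (D : Partial m W) (p : Node D) {Z B : Subset m} → Border D p Z B → ∣ Z ∣ ≡ M →
    (∀ {B′} → ∣ B′ ∣ < ∣ B ∣ → ∀ {Z′} D′ p′ → Border D′ p′ Z′ B′ → ∣ Z′ ∣ ≤ M → Extension R D′ B′) → Extension R D B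
  split D p {Z} {B} (Z⊆B , Z⊆p , used⊆Z) Z≡M rec = go (well-linked? (restricted? B) Z N)
    where
    go : _ → Extension R D B
    go (inj₁ linked) = ⊥-elim (unlinked B Z Z≡M linked)
    go (inj₂ (P , Q , sep , order , ¬bigP , ¬bigQ)) = record
      { result = E₂.result ; embed = E₂.embed ∘ E₁.embed ∘ fsuc
      ; same = λ j → trans (E₂.same (E₁.embed (fsuc j))) (E₁.same (fsuc j))
      ; used = λ x∈ → [ used₁ , inj₂ ∘ proj₁ ∘ x∈p∩q⁻ B Q ]′ (E₂.used x∈)
      ; cover-v = cover-v′ ; cover-e = cover-e′ }
      where
      open Separation sep
      S : Subset m
      S = P ∩ Q
      bag₀ : Subset m
      bag₀ = Z ∪ (S ∩ B)
      bag₀⊆B : bag₀ ⊆ B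
      bag₀⊆B x∈ = [ Z⊆B , proj₂ ∘ x∈p∩q⁻ S B ]′ (x∈p∪q⁻ Z (S ∩ B) x∈)
      ∣S∩B∣≤N : ∣ S ∩ B ∣ ≤ N
      ∣S∩B∣≤N = ≤-trans (∣p∩q∣≤∣p∣ S B) order
      D₀ : Partial m W
      D₀ = attach D p bag₀ (≤-trans (∣p∣≤∣q∣+∣r∣ (x∈p∪q⁻ Z (S ∩ B))) (+-mono-≤ (≤-reflexive Z≡M) ∣S∩B∣≤N))
        λ x∈ x∈j → Z⊆p (used⊆Z x∈j (bag₀⊆B x∈))
      border : Subset m → Subset m
      border X = (Z ∩ X) ∪ (S ∩ B)
      ∣border∣≤M : ∀ {X} → ¬ Big Z N X → ∣ border X ∣ ≤ M
      ∣border∣≤M {X} ¬big = ≤-trans (∣p∣≤∣q∣+∣r∣ (x∈p∪q⁻ (Z ∩ X) (S ∩ B)))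
        (≤-trans (+-monoʳ-≤ ∣ Z ∩ X ∣ ∣S∩B∣≤N) (subst (∣ Z ∩ X ∣ + N ≤_) Z≡M (≮⇒≥ ¬big)))
      smaller : ∀ {X} → ¬ Big Z N X → ∣ B ∩ X ∣ < ∣ B ∣
      -- Since `0 < N`, a side that is not big misses a vertex of `Z`.
      smaller {X} ¬big = p⊂q⇒∣p∣<∣q∣ (p∩q⊆p B X ,
        (let z , z∈Z , z∉ = ∣p∣<∣q∣⇒∃ {p = Z ∩ X} {Z} (<-≤-trans (m<m+n ∣ Z ∩ X ∣ 0<N) (≮⇒≥ ¬big)) in
        z , Z⊆B z∈Z , λ z∈BX → z∉ (x∈p∩q⁺ (z∈Z , proj₂ (x∈p∩q⁻ B X z∈BX)))))
      border⊆ : ∀ {X} → S ⊆ X → border X ⊆ B ∩ X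
      border⊆ {X} S⊆X x∈ = [ (λ x∈ZX → let a , b = x∈p∩q⁻ Z X x∈ZX in x∈p∩q⁺ (Z⊆B a , b))
        , (λ x∈SB → let a , b = x∈p∩q⁻ S B x∈SB in x∈p∩q⁺ (b , S⊆X a)) ]′ (x∈p∪q⁻ (Z ∩ X) (S ∩ B) x∈)
      border⊆bag₀ : ∀ X → border X ⊆ bag₀
      border⊆bag₀ X x∈ = [ p⊆p∪q (S ∩ B) ∘ proj₁ ∘ x∈p∩q⁻ Z X , q⊆p∪q Z (S ∩ B) ]′ (x∈p∪q⁻ (Z ∩ X) (S ∩ B) x∈)
      used₀ : ∀ X {j x} → x ∈ Partial.bag D₀ j → x ∈ B ∩ X → x ∈ border X
      used₀ X {fzero} x∈ x∈BX = [ (λ x∈Z → p⊆p∪q (S ∩ B) (x∈p∩q⁺ (x∈Z , proj₂ (x∈p∩q⁻ B X x∈BX))))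
        , q⊆p∪q (Z ∩ X) (S ∩ B) ]′ (x∈p∪q⁻ Z (S ∩ B) x∈)
      used₀ X {fsuc j} x∈ x∈BX = let x∈B , x∈X = x∈p∩q⁻ B X x∈BX in
        p⊆p∪q (S ∩ B) (x∈p∩q⁺ (used⊆Z x∈ x∈B , x∈X))
      extension-P : Extension R D₀ (B ∩ P)
      extension-P = rec (smaller ¬bigP) D₀ fzero
        (border⊆ (p∩q⊆p P Q) , border⊆bag₀ P , (λ {j} → used₀ P {j})) (∣border∣≤M ¬bigP)
      module E₁ = Extension extension-P
      -- A vertex of `Q` newly placed by the first call lies in `P` too, hence in the separator.
      used-Q : ∀ {j x} → x ∈ Partial.bag E₁.result j → x ∈ B ∩ Q → x ∈ border Q
      used-Q x∈ x∈BQ with E₁.used x∈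
      ... | inj₁ (i , x∈i) = used₀ Q {i} x∈i x∈BQ
      ... | inj₂ x∈BP = let x∈B , x∈Q = x∈p∩q⁻ B Q x∈BQ in
        q⊆p∪q (Z ∩ Q) (S ∩ B) (x∈p∩q⁺ (x∈p∩q⁺ (proj₂ (x∈p∩q⁻ B P x∈BP) , x∈Q) , x∈B))
      extension-Q : Extension R E₁.result (B ∩ Q)
      extension-Q = rec (smaller ¬bigQ) E₁.result (E₁.embed fzero)
        ( border⊆ (p∩q⊆q P Q)
        , (λ x∈ → subst (_ ∈_) (sym (E₁.same fzero)) (border⊆bag₀ Q x∈))
        , (λ {j} → used-Q {j}))
        (∣border∣≤M ¬bigQ)
      module E₂ = Extension extension-Q
      used₁ : ∀ {x} → (∃[ i ] x ∈ Partial.bag E₁.result i) → (∃[ i ] x ∈ Partial.bag D i) ⊎ x ∈ B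
      used₁ (i , x∈) with E₁.used x∈
      ... | inj₁ (fzero , x∈₀) = inj₂ (bag₀⊆B x∈₀)
      ... | inj₁ (fsuc j , x∈j) = inj₁ (j , x∈j)
      ... | inj₂ x∈BP = inj₂ (proj₁ (x∈p∩q⁻ B P x∈BP))
      bag′ = Partial.bag E₂.result
      transfer : ∀ {x j} → x ∈ Partial.bag E₁.result j → x ∈ bag′ (E₂.embed j)
      transfer {j = j} x∈ = subst (_ ∈_) (sym (E₂.same j)) x∈
      cover-v′ : ∀ {x} → x ∈ B → ∃[ j ] x ∈ bag′ j
      cover-v′ {x} x∈B with cover x
      ... | inj₁ x∈P = let j , x∈j = E₁.cover-v (x∈p∩q⁺ (x∈B , x∈P)) in E₂.embed j , transfer x∈j
      ... | inj₂ x∈Q = E₂.cover-v (x∈p∩q⁺ (x∈B , x∈Q))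
      cover-e′ : ∀ {u v} → R u v → u ∈ B → v ∈ B → ∃[ j ] (u ∈ bag′ j × v ∈ bag′ j)
      cover-e′ {u} {v} r u∈B v∈B with u ∈? P | v ∈? P | u ∈? Q | v ∈? Q
      ... | yes u∈P | yes v∈P | _ | _ = let j , u∈j , v∈j = E₁.cover-e r (x∈p∩q⁺ (u∈B , u∈P)) (x∈p∩q⁺ (v∈B , v∈P)) in
              E₂.embed j , transfer u∈j , transfer v∈j
      ... | _ | _ | yes u∈Q | yes v∈Q = E₂.cover-e r (x∈p∩q⁺ (u∈B , u∈Q)) (x∈p∩q⁺ (v∈B , v∈Q))
      ... | no u∉P | _ | no u∉Q | _ = ⊥-elim (u∉P (∉Q⇒∈P u∉Q))
      ... | _ | no v∉P | _ | no v∉Q = ⊥-elim (v∉P (∉Q⇒∈P v∉Q))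
      ... | no u∉P | yes _ | yes _ | no v∉Q = ⊥-elim (nocross (R-sym r , v∈B , u∈B) v∉Q u∉P)
      ... | yes _ | no v∉P | no u∉Q | yes _ = ⊥-elim (nocross (r , u∈B , v∈B) u∉Q v∉P)

  -- Two nested inductions: splitting shrinks `B`, and enlarging the border shrinks `B ∩ ∁ Z` while
  -- `B` is fixed.
  decompose : ∀ {B} → Acc _<_ ∣ B ∣ → ∀ {Z} (D : Partial m W) (p : Node D) →
    Border D p Z B → ∣ Z ∣ ≤ M → Extension R D B
  decompose {B} (acc smaller) = go (<-wellFounded _)
    where
    go : ∀ {Z} → Acc _<_ ∣ B ∩ ∁ Z ∣ → (D : Partial m W) (p : Node D) → Border D p Z B → ∣ Z ∣ ≤ M → Extension R D B
    go {Z} (acc smallerZ) D p border Z≤M with ∣ Z ∣ <? M | any? (λ v → (v ∈? B) ×-dec ¬? (v ∈? Z))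
    ... | no ≮M | _ = split D p border (≤-antisym Z≤M (≮⇒≥ ≮M)) λ lt → decompose (smaller lt)
    ... | yes Z<M | no none = trivial D p border λ {x} x∈B → B⊆Z x∈B (x ∈? Z)
      where
      B⊆Z : ∀ {x} → x ∈ B → Dec (x ∈ Z) → x ∈ Z
      B⊆Z _ (yes x∈Z) = x∈Z
      B⊆Z {x} x∈B (no x∉Z) = ⊥-elim (none (x , x∈B , x∉Z))
    ... | yes Z<M | yes (v , v∈B , v∉Z) = enlarge D p border Z<M v∈B v∉Z
      (go (smallerZ (p⊂q⇒∣p∣<∣q∣
        ( (λ x∈ → let x∈B , x∈∁ = x∈p∩q⁻ B _ x∈ in
            x∈p∩q⁺ (x∈B , x∉p⇒x∈∁p (x∈∁p⇒x∉p x∈∁ ∘ p⊆p∪q ⁅ v ⁆)))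
        , v , x∈p∩q⁺ (v∈B , x∉p⇒x∈∁p v∉Z)
        , λ v∈ → x∈∁p⇒x∉p (proj₂ (x∈p∩q⁻ B _ v∈)) (q⊆p∪q Z _ (x∈⁅x⁆ v))))))

tree-decomposition : (G : Graph) {M N w : ℕ} → 0 < N → M + N ≤ suc w →
  (∀ B Z → ∣ Z ∣ ≡ M → ¬ WellLinked (Restricted (Edge G) B) Z N) → TreewidthAtMost G w
tree-decomposition G {M} {N} 0<N M+N≤ unlinked = record
  { T = T ; tree = tree ; bag = bag
  ; cover-v = λ v → E.cover-v ∈⊤ ; cover-e = λ u v e → E.cover-e e ∈⊤ ∈⊤
  ; coherent = λ v s t v∈s v∈t → walk⇒WalkIn (coherent v s t v∈s v∈t)
  ; width = λ t → ≤-trans (width t) M+N≤ }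
  where
  adj? : ∀ u v → Dec (Edge G u v)
  adj? u v = adj G u v ≟ᵇ true
  whole : Extension {W = M + N} (Edge G) singleton ⊤ˢ
  whole = Decompose.decompose adj? (λ {u} {v} → Edge-sym G {u} {v}) 0<N unlinked (<-wellFounded _) {⊥ˢ} singleton fzero
    (⊥⊆ , ⊥⊆ , λ x∈ _ → x∈) (≤-trans (≤-reflexive (∣⊥∣≡0 (n G))) z≤n)
  module E = Extension whole
  open Partial E.result

-- Disjoint models from a well-linked set, and the numerical bound

models : ∀ {G H k} {B : Subset (n G)} → Model (Restricted (Edge G) B) (Copies k (Edge H)) → DisjointMinorModels G H k
models M = record
  { φ = λ i u → part (i , u)
  ; nonempty = λ i u → nonempty (i , u)
  ; connected = λ i u x y x∈ y∈ → walk⇒WalkIn (walk-map proj₁ id (conn (i , u) x y x∈ y∈))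
  ; disjoint = λ i j u v ne x x∈ x∈′ → ne (disjoint (i , u) (j , v) x∈ x∈′)
  ; edges = λ i u v e → let x , y , x∈ , y∈ , r , _ = touch (refl , e) in x , y , x∈ , y∈ , r }
  where open Model M

linked-models : ∀ {G H} k {h N} → PathwidthAtMost H 2 → 0 < n H → k * n H * (k * n H) < h → (h + h) * 2 ≤ N →
  ∀ {B Z} → 5 * N ≤ ∣ Z ∣ → WellLinked (Restricted (Edge G) B) Z N → DisjointMinorModels G H k
linked-models {G} {H} k PD 0<n s²<h 4h≤N {B} {Z} Z-large linked =
  let π , π-inj , ladder = Rungs.twisted-ladder R? R-sym {Z} Z-large linked 4h≤N in
  models (contract R-sym search-Pos (copies k (ladder-contains PD 0<n))
    (contract R-sym search-Pos (straight-ladder (k * n H) s²<h π-inj) ladder))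
  where
  R? : ∀ u v → Dec (Restricted (Edge G) B u v)
  R? u v = (adj G u v ≟ᵇ true) ×-dec (u ∈? B) ×-dec (v ∈? B)
  R-sym : ∀ {u v} → Restricted (Edge G) B u v → Restricted (Edge G) B v u
  R-sym {u} {v} (e , u∈ , v∈) = Edge-sym G {u} {v} e , v∈ , u∈

m<2^m : ∀ m → m < 2 ^ m
m<2^m zero = s≤s z≤n
m<2^m (suc m) = ≤-trans (+-mono-≤ (≤-trans (s≤s z≤n) (m<2^m m)) (m<2^m m))
  (≤-reflexive (cong (2 ^ m +_) (sym (+-identityʳ (2 ^ m)))))

-- Raising 24 to 32 and bounding 1 by `s * s` gives `64 * (r * r) * (k * k)`. Here `64 = 2 ^ 6` is
-- at most `2 ^ (6 * (r * r))`, and the factor `r * r` is below `2 ^ (r * r)`: hence the 7.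
width-bound : ∀ k r → 1 ≤ k → 1 ≤ r → let s = k * r ; h = suc (s * s) ; N = (h + h) * 2 in
  5 * N + N ≤ 2 ^ (7 * (r * r)) * (k * k)
width-bound k r 1≤k 1≤r = begin
  5 * ((h + h) * 2) + (h + h) * 2  ≡⟨ solve 1 (λ h → con 5 :* ((h :+ h) :* con 2) :+ (h :+ h) :* con 2 := con 24 :* h) refl h ⟩
  24 * (1 + s * s)                 ≤⟨ *-monoʳ-≤ 24 (+-monoˡ-≤ (s * s) (*-mono-≤ (*-mono-≤ 1≤k 1≤r) (*-mono-≤ 1≤k 1≤r))) ⟩
  24 * (s * s + s * s)             ≤⟨ *-monoˡ-≤ (s * s + s * s) (m≤m+n 24 8) ⟩
  32 * (s * s + s * s)             ≡⟨ solve 2 (λ k r → con 32 :* (k :* r :* (k :* r) :+ k :* r :* (k :* r)) := con 64 :* (r :* r) :* (k :* k)) refl k r ⟩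
  64 * (r * r) * (k * k)           ≤⟨ *-monoˡ-≤ (k * k) (*-mono-≤ (^-monoʳ-≤ 2 {6} (*-monoʳ-≤ 6 (*-mono-≤ 1≤r 1≤r))) (<⇒≤ (m<2^m (r * r)))) ⟩
  2 ^ (6 * (r * r)) * 2 ^ (r * r) * (k * k)  ≡⟨ cong (_* (k * k)) (trans (sym (^-distribˡ-+-* 2 (6 * (r * r)) (r * r)))
                                                                         (cong (2 ^_) (+-comm (6 * (r * r)) (r * r)))) ⟩
  2 ^ (7 * (r * r)) * (k * k)      ∎
  where
  open ≤-Reasoning
  s h : ℕ
  s = k * r
  h = suc (s * s)

-- The logarithm is removed by exponentiation: `2 ^ w ≤ (2 * k) ^ e` says that `w` is at most `e`
-- times the binary logarithm of `2 * k`.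
theorem3 : ∃[ c ] ∀ (H : Graph) → PathwidthAtMost H 2 → 5 < n H →
    ∀ (k : ℕ) → 1 ≤ k → ∀ (G : Graph) → ¬ DisjointMinorModels G H k →
    ∃[ w ] (TreewidthAtMost G w ×
    2 ^ w ≤ (2 * k) ^ (2 ^ (c * (n H * n H)) * (k * k)))
theorem3 = 7 , λ H PD 5<n k 1≤k G ¬models →
  let 0<n = ≤-trans (s≤s z≤n) 5<n
      s = k * n H
      h = suc (s * s)
      N = (h + h) * 2
      w = 5 * N + N
  in w ,
    tree-decomposition G {5 * N} {N} (s≤s z≤n) (n≤1+n w) (λ B Z ∣Z∣≡ linked →
      ¬models (linked-models k PD 0<n ≤-refl ≤-refl {B} {Z} (≤-reflexive (sym ∣Z∣≡)) linked)) ,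
    -- As `k` is positive, `2 ≤ 2 * k`: the bases are compared first, then the exponents.
    ≤-trans (^-monoˡ-≤ w (*-monoʳ-≤ 2 1≤k))
      (^-monoʳ-≤ (2 * k) {{>-nonZero (≤-trans (s≤s z≤n) (*-monoʳ-≤ 2 1≤k))}} (width-bound k (n H) 1≤k 0<n))
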